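{- Let $\delta>0$ and let $k\geq2$ be an integer. Let $m=\mathrm{EDHJ}(k,\delta/4)$. Then for every integer $n\geq\max\{m,4k^2/\delta\}$ and every $A\subseteq[k]^n$ of equal-slices density at least $\delta$, the equal-slices density of the set of combinatorial lines contained in $A$ is at least $(\delta/9)(k+1)^{ -m}$.
   Context: The equal-slices measure on $[k]^n$: choose uniformly a $k$-tuple $(a_1,\dots,a_k)$ of non-negative integers summing to $n$, then choose $x\in[k]^n$ uniformly among sequences with exactly $a_j$ coordinates equal to $j$ for each $j$. A combinatorial line in $[k]^n$: partition $[n]$ into $X_1,\dots,X_k,W$ with $W\neq\emptyset$ and take the $k$ points equal to $j$ on $X_j$ and constant on $W$. Lines (allowing also degenerate ones with $W=\emptyset$) are identified with points $y\in[k+1]^n$: $y$ corresponds to the set $\{y^{k+1\rightarrow j}:j\in[k]\}$, where $y^{k+1\rightarrow j}$ replaces every coordinate equal to $k+1$ by $j$. A line is contained in $A$ if all its points lie in $A$; the equal-slices density of a set of lines is the equal-slices measure of the corresponding subset of $[k+1]^n$. $\mathrm{EDHJ}(k,\alpha)$ is the smallest positive integer $m$ such that every subset of $[k]^m$ of equal-slices density at least $\alpha$ contains a combinatorial line (such $m$ exists).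
   Formalization: The density parameter δ > 0 is taken to be a rational number rather than an arbitrary real number. -}

module Defs where

open import Data.Nat as ℕ using (ℕ; zero; suc; _+_; _*_; _∸_; _≡ᵇ_)
open import Data.Fin as Fin using (Fin; toℕ; fromℕ; lower₁)
open import Data.Vec as Vec using (Vec; []; _∷_; lookup)
open import Data.List as List using (List; [_]; concatMap; map; upTo; allFin; foldr; filterᵇ; length)
open import Data.Bool using (Bool; true; false; if_then_else_; _∧_)
open import Data.Integer using (+_)
open import Data.Rational as ℚ using (ℚ; 0ℚ; _≤_)
open import Data.Product using (Σ; _×_; ∃)
open import Relation.Nullary using (¬_; yes; no)
open import Relation.Binary.PropositionalEquality using (_≡_)

Subset : ℕ → ℕ → Set
Subset k n = Vec (Fin k) n → Bool

allPoints : (k n : ℕ) → List (Vec (Fin k) n)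
allPoints k zero    = [ [] ]
allPoints k (suc n) = concatMap (λ c → map (c ∷_) (allPoints k n)) (allFin k)

compositions : (k n : ℕ) → List (Vec ℕ k)
compositions zero    n = if n ≡ᵇ 0 then [ [] ] else List.[]
compositions (suc k) n =
  concatMap (λ i → map (i ∷_) (compositions k (n ∸ i))) (upTo (suc n))

count : ∀ {k n} → Vec (Fin k) n → Fin k → ℕ
count []      j = 0
count (c ∷ x) j = (if toℕ c ≡ᵇ toℕ j then 1 else 0) + count x j

sliceOf : ∀ {k n} → Vec (Fin k) n → Vec ℕ k
sliceOf x = Vec.tabulate (count x)

_≡ᵛ_ : ∀ {k} → Vec ℕ k → Vec ℕ k → Bool
[]      ≡ᵛ []      = true
(a ∷ u) ≡ᵛ (b ∷ v) = (a ≡ᵇ b) ∧ (u ≡ᵛ v)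

sliceSize : ∀ {k n} → Vec (Fin k) n → ℕ
sliceSize {k} {n} x = length (filterᵇ (λ y → sliceOf y ≡ᵛ sliceOf x) (allPoints k n))

-- p / q as a rational (0 if q = 0; never used with q = 0 below)
frac : ℕ → ℕ → ℚ
frac p zero    = 0ℚ
frac p (suc q) = (+ p) ℚ./ suc q

-- equal-slices probability of the point x ∈ [k]^n:
-- uniform slice, then uniform point in that slice
esWeight : ∀ {k n} → Vec (Fin k) n → ℚ
esWeight {k} {n} x = frac 1 (length (compositions k n) * sliceSize x)

esDensity : ∀ {k n} → Subset k n → ℚ
esDensity {k} {n} A =
  foldr (λ x s → (if A x then esWeight x else 0ℚ) ℚ.+ s) 0ℚ (allPoints k n)

-- y^{k+1 → j}: replace coordinates equal to k+1 (= fromℕ k) by j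
replaceTop : ∀ {k} → Fin k → Fin (suc k) → Fin k
replaceTop {k} j c with k ℕ.≟ toℕ c
... | yes _ = j
... | no ne = lower₁ c ne

substTop : ∀ {k n} → Fin k → Vec (Fin (suc k)) n → Vec (Fin k) n
substTop j y = Vec.map (replaceTop j) y

isTop : ∀ {k} → Fin (suc k) → Bool
isTop {k} c = toℕ c ≡ᵇ k

anyᵇ : ∀ {A : Set} {n} → (A → Bool) → Vec A n → Bool
anyᵇ p []      = false
anyᵇ p (a ∷ v) = if p a then true else anyᵇ p v

allᵇ : ∀ {A : Set} → (A → Bool) → List A → Bool
allᵇ p = foldr (λ a b → p a ∧ b) true

-- y ∈ [k+1]^n is a (non-degenerate, i.e. W ≠ ∅) combinatorial line contained in A
lineIn : ∀ {k n} → Subset k n → Vec (Fin (suc k)) n → Bool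
lineIn {k} A y = anyᵇ isTop y ∧ allᵇ (λ j → A (substTop j y)) (allFin k)

linesIn : ∀ {k n} → Subset k n → Subset (suc k) n
linesIn A = lineIn A

ContainsLine : ∀ {k n} → Subset k n → Set
ContainsLine {k} {n} A = ∃ λ (y : Vec (Fin (suc k)) n) → lineIn A y ≡ true

EDHJProp : ℕ → ℚ → ℕ → Set
EDHJProp k α m = (A : Subset k m) → α ≤ esDensity A → ContainsLine A

IsEDHJ : ℕ → ℚ → ℕ → Set
IsEDHJ k α m =
  (1 ℕ.≤ m) × EDHJProp k α m × (∀ m' → 1 ℕ.≤ m' → m' ℕ.< m → ¬ EDHJProp k α m')

{-# OPTIONS --safe #-}

-- Give a point x the weight ∏ a_j!, which is its equal-slices measure up to normalisation. In this
-- measure the i-th coordinate, given the others, is a uniformly random choice among k fresh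
-- constants and the copies of the other coordinates (Pólya's urn). Hence the mass of A is the sum of
-- the masses of its restrictions to the hyperplanes "coordinate i is a constant or a copy". Lines of
-- hyperplanes are lines of [k]^(n+1), and after summing over i as well a line receives at most n
-- times its own weight. This transfers linear bounds of the form "mass of A ≤ α + C · mass of lines"
-- from dimension m to every n ≥ m.
-- In dimension m such a bound comes from deleting one point of every line in A: what remains has no
-- line, so its density is below δ/4, and a deleted point weighs at most 2^m times its line. This is
-- stronger than bounding the measure of a single line from below, which would not give (k+1)^(-m)
-- because a balanced line has smaller measure than that.

module Submission where

open import Defs
open import Algebra.Bundles using (CommutativeMonoid)
open import Data.Bool using (Bool; true; false; T; not; _∧_; if_then_else_)
open import Data.Bool.ListAction using (any)
open import Data.Bool.Properties using (T-∧; T-≡)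
open import Data.Fin as Fin using (Fin; zero; suc; toℕ; fromℕ; inject₁)
import Data.Fin.Properties as Finₚ
open import Data.Fin.Relation.Unary.Top using (view; ‵fromℕ; ‵inj₁)
open import Data.Integer as ℤ using (+[1+_])
import Data.Integer.Properties as ℤₚ
open import Data.List using (List; []; _∷_; _++_; map; concatMap; length; allFin; filterᵇ; upTo; applyUpTo; foldr)
open import Data.List.Membership.Propositional using (_∈_; lose)
open import Data.List.Membership.Propositional.Properties using (∈-allFin; ∈-map⁺; ∈-concatMap⁺)
import Data.List.Properties as Listₚ
open import Data.List.Relation.Unary.Any using (here; there)
open import Data.List.Relation.Unary.Any.Properties using (any⁺)
open import Data.Nat as ℕ using (ℕ; zero; suc; _+_; _*_; _∸_; _^_; _≡ᵇ_; _!; _≤′_; ≤′-refl; ≤′-step; z≤n; s≤s; NonZero)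
open import Data.Nat.ListAction using (sum)
open import Data.Nat.ListAction.Properties using (sum-++)
import Data.Nat.Properties as ℕₚ
open import Data.Nat.Tactic.RingSolver using (solve-∀)
open import Data.Product using (∃; ∃₂; _×_; _,_; proj₁; proj₂)
open import Data.Rational as ℚ using (ℚ; 0ℚ; _≤_; _÷_; Positive; mkℚ; toℚᵘ)
import Data.Rational.Properties as ℚₚ
open import Data.Rational.Properties using (pos⇒nonZero)
open import Data.Rational.Unnormalised as ℚᵘ using (mkℚᵘ; *≡*; *≤*)
import Data.Rational.Unnormalised.Properties as ℚᵘₚ
open import Data.Sum using (_⊎_; inj₁; inj₂)
open import Data.Unit using (tt)
open import Data.Vec using (Vec; []; _∷_; lookup; insertAt; removeAt)
import Data.Vec.Properties as Vecₚ
open import Function using (_∘_; const; Equivalence)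
open import Relation.Binary.PropositionalEquality
open import Relation.Nullary using (¬_; Dec; yes; no; does; contradiction)
open import Relation.Nullary.Decidable using (dec-true)

private variable
  A B : Set
  k n : ℕ

-- Finite sums

∑ : List A → (A → ℕ) → ℕ
∑ xs f = sum (map f xs)

infix 5 ∑
syntax ∑ xs (λ x → e) = ∑[ x ∈ xs ] e

∑-cong : ∀ (xs : List A) {f g : A → ℕ} → (∀ x → f x ≡ g x) → ∑ xs f ≡ ∑ xs g
∑-cong xs f≗g = cong sum (Listₚ.map-cong f≗g xs)

∑-mono : ∀ (xs : List A) {f g : A → ℕ} → (∀ x → f x ℕ.≤ g x) → ∑ xs f ℕ.≤ ∑ xs g
∑-mono []       f≤g = z≤n
∑-mono (x ∷ xs) f≤g = ℕₚ.+-mono-≤ (f≤g x) (∑-mono xs f≤g)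

∑-const : ∀ (xs : List A) c → ∑ xs (λ _ → c) ≡ length xs * c
∑-const []       c = refl
∑-const (_ ∷ xs) c = cong (c +_) (∑-const xs c)

∑-zero : ∀ (xs : List A) → ∑ xs (λ _ → 0) ≡ 0
∑-zero xs = trans (∑-const xs 0) (ℕₚ.*-zeroʳ (length xs))

∑-allFin-const : ∀ n c → ∑ (allFin n) (λ _ → c) ≡ n * c
∑-allFin-const n c = trans (∑-const (allFin n) c) (cong (_* c) (Listₚ.length-tabulate {n = n} (λ i → i)))

∑-+ : ∀ (xs : List A) (f g : A → ℕ) → ∑[ x ∈ xs ] (f x + g x) ≡ ∑ xs f + ∑ xs g
∑-+ []       f g = refl
∑-+ (x ∷ xs) f g rewrite ∑-+ xs f g = interchange (f x) (g x) (∑ xs f) (∑ xs g)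
  where
  interchange : ∀ a b c d → a + b + (c + d) ≡ a + c + (b + d)
  interchange = solve-∀

∑-*ˡ : ∀ (xs : List A) c (f : A → ℕ) → ∑[ x ∈ xs ] (c * f x) ≡ c * ∑ xs f
∑-*ˡ []       c f = sym (ℕₚ.*-zeroʳ c)
∑-*ˡ (x ∷ xs) c f rewrite ∑-*ˡ xs c f = sym (ℕₚ.*-distribˡ-+ c (f x) (∑ xs f))

∑-swap : ∀ (xs : List A) (ys : List B) (f : A → B → ℕ) →
         ∑[ x ∈ xs ] ∑[ y ∈ ys ] f x y ≡ ∑[ y ∈ ys ] ∑[ x ∈ xs ] f x y
∑-swap []       ys f = sym (∑-zero ys)
∑-swap (x ∷ xs) ys f =
  trans (cong (∑ ys (f x) +_) (∑-swap xs ys f)) (sym (∑-+ ys (f x) (λ y → ∑[ z ∈ xs ] f z y)))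

∑-map : ∀ (xs : List A) (g : A → B) (f : B → ℕ) → ∑ (map g xs) f ≡ ∑ xs (f ∘ g)
∑-map xs g f = cong sum (sym (Listₚ.map-∘ xs))

∑-++ : ∀ (xs ys : List A) (f : A → ℕ) → ∑ (xs ++ ys) f ≡ ∑ xs f + ∑ ys f
∑-++ xs ys f = trans (cong sum (Listₚ.map-++ f xs ys)) (sum-++ (map f xs) (map f ys))

∑-concatMap : ∀ (xs : List A) (g : A → List B) (f : B → ℕ) →
              ∑ (concatMap g xs) f ≡ ∑[ x ∈ xs ] ∑ (g x) f
∑-concatMap []       g f = refl
∑-concatMap (x ∷ xs) g f = begin
  ∑ (g x ++ concatMap g xs) f           ≡⟨ ∑-++ (g x) (concatMap g xs) f ⟩
  ∑ (g x) f + ∑ (concatMap g xs) f      ≡⟨ cong (∑ (g x) f +_) (∑-concatMap xs g f) ⟩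
  ∑ (g x) f + (∑[ y ∈ xs ] ∑ (g y) f)  ∎
  where open ≡-Reasoning

∑-allFin : ∀ (f : Fin (suc n) → ℕ) → ∑ (allFin (suc n)) f ≡ f zero + ∑ (allFin n) (f ∘ suc)
∑-allFin {n} f = cong (λ xs → f zero + sum xs) (trans (Listₚ.map-tabulate suc f) (sym (Listₚ.map-tabulate (λ i → i) (f ∘ suc))))

∑-allPoints : ∀ (f : Vec (Fin k) (suc n) → ℕ) →
              ∑ (allPoints k (suc n)) f ≡ ∑[ c ∈ allFin k ] ∑[ x ∈ allPoints k n ] f (c ∷ x)
∑-allPoints {k} {n} f = trans (∑-concatMap (allFin k) _ f)
  (∑-cong (allFin k) λ c → ∑-map (allPoints k n) (c ∷_) f)

-- Removing coordinate `i` is a bijection onto pairs of a shorter vector and a letter, so a sum over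
-- the cube can be fibred over any coordinate, not only over the head.
∑-insertAt : ∀ (i : Fin (suc n)) (f : Vec (Fin k) (suc n) → ℕ) →
             ∑ (allPoints k (suc n)) f ≡ ∑[ x ∈ allPoints k n ] ∑[ c ∈ allFin k ] f (insertAt x i c)
∑-insertAt {n} {k} zero f = trans (∑-allPoints f) (∑-swap (allFin k) (allPoints k n) (λ c x → f (c ∷ x)))
∑-insertAt {suc n} {k} (suc i) f = begin
  ∑ (allPoints k (suc (suc n))) f
    ≡⟨ ∑-allPoints f ⟩
  ∑[ d ∈ allFin k ] ∑[ u ∈ allPoints k (suc n) ] f (d ∷ u)
    ≡⟨ ∑-cong (allFin k) (λ d → ∑-insertAt i (f ∘ (d ∷_))) ⟩
  ∑[ d ∈ allFin k ] ∑[ x ∈ allPoints k n ] ∑[ c ∈ allFin k ] f (d ∷ insertAt x i c)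
    ≡⟨ ∑-allPoints (λ x → ∑[ c ∈ allFin k ] f (insertAt x (suc i) c)) ⟨
  ∑[ x ∈ allPoints k (suc n) ] ∑[ c ∈ allFin k ] f (insertAt x (suc i) c) ∎
  where open ≡-Reasoning

-- Letter counts and weights.

hit : Fin k → Fin k → ℕ
hit c j = if toℕ c ≡ᵇ toℕ j then 1 else 0

hit-refl : ∀ (c : Fin k) → hit c c ≡ 1
hit-refl zero    = refl
hit-refl (suc c) = hit-refl c

hit-≢ : ∀ {c j : Fin k} → c ≢ j → hit c j ≡ 0
hit-≢ {c = zero}  {zero}  c≢j = contradiction refl c≢j
hit-≢ {c = zero}  {suc j} c≢j = refl
hit-≢ {c = suc c} {zero}  c≢j = refl
hit-≢ {c = suc c} {suc j} c≢j = hit-≢ (c≢j ∘ cong suc)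

∑-hit : ∀ (c : Fin k) (h : Fin k → ℕ) → ∑[ j ∈ allFin k ] (hit c j * h j) ≡ h c
∑-hit {suc k} zero h = begin
  ∑[ j ∈ allFin (suc k) ] (hit zero j * h j)  ≡⟨ ∑-allFin (λ j → hit zero j * h j) ⟩
  (h zero + 0) + (∑[ j ∈ allFin k ] 0)  ≡⟨ cong₂ _+_ (ℕₚ.+-identityʳ (h zero)) (∑-zero (allFin k)) ⟩
  h zero + 0                                  ≡⟨ ℕₚ.+-identityʳ (h zero) ⟩
  h zero                                      ∎
  where open ≡-Reasoning
∑-hit (suc c) h = trans (∑-allFin (λ j → hit (suc c) j * h j)) (∑-hit c (h ∘ suc))

-- Double counting of positions by the letter they carry. This turns copying a uniformly chosen
-- coordinate into choosing a letter with probability proportional to its count.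
∑-lookup : ∀ (x : Vec (Fin k) n) (h : Fin k → ℕ) →
           ∑[ i ∈ allFin n ] h (lookup x i) ≡ ∑[ c ∈ allFin k ] (count x c * h c)
∑-lookup {k} []  h = sym (∑-zero (allFin k))
∑-lookup {k} {suc n} (d ∷ x) h = begin
  ∑[ i ∈ allFin (suc n) ] h (lookup (d ∷ x) i)
    ≡⟨ ∑-allFin (λ i → h (lookup (d ∷ x) i)) ⟩
  h d + (∑[ i ∈ allFin n ] h (lookup x i))
    ≡⟨ cong₂ _+_ (sym (∑-hit d h)) (∑-lookup x h) ⟩
  (∑[ c ∈ allFin k ] (hit d c * h c)) + (∑[ c ∈ allFin k ] (count x c * h c))
    ≡⟨ ∑-+ (allFin k) _ _ ⟨
  ∑[ c ∈ allFin k ] (hit d c * h c + count x c * h c)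
    ≡⟨ ∑-cong (allFin k) (λ c → sym (ℕₚ.*-distribʳ-+ (h c) (hit d c) (count x c))) ⟩
  ∑[ c ∈ allFin k ] (count (d ∷ x) c * h c) ∎
  where open ≡-Reasoning

count-insertAt : ∀ (x : Vec (Fin k) n) i c j → count (insertAt x i c) j ≡ hit c j + count x j
count-insertAt x       zero    c j = refl
count-insertAt (d ∷ x) (suc i) c j rewrite count-insertAt x i c j = left-comm (hit d j) (hit c j) (count x j)
  where
  left-comm : ∀ a b e → a + (b + e) ≡ b + (a + e)
  left-comm = solve-∀

-- The product of the factorials of the counts; the equal-slices weight of x is proportional to it.
weight : Vec (Fin k) n → ℕ
weight []      = 1
weight (c ∷ x) = weight x * suc (count x c)

-- The weight depends only on the counts, so it does not matter where a letter is inserted. Moving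
-- `c` past the head `d` swaps two factors: for equal letters both orders give the same expression,
-- and for distinct ones neither count sees the other letter.
weight-insertAt : ∀ (x : Vec (Fin k) n) i c → weight (insertAt x i c) ≡ weight x * suc (count x c)
weight-insertAt x       zero    c = refl
weight-insertAt (d ∷ x) (suc i) c rewrite weight-insertAt x i c | count-insertAt x i c d
  with c Fin.≟ d
... | yes refl = refl
... | no c≢d rewrite hit-≢ c≢d | hit-≢ (c≢d ∘ sym) = right-comm (weight x) (suc (count x c)) (suc (count x d))
  where
  right-comm : ∀ a b e → a * b * e ≡ a * e * b
  right-comm = solve-∀

-- Normalisation of the weights

weight-removeAt : ∀ (u : Vec (Fin k) (suc n)) i →
                  weight u ≡ weight (removeAt u i) * suc (count (removeAt u i) (lookup u i))
weight-removeAt u i =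
  trans (cong weight (sym (Vecₚ.insertAt-removeAt u i))) (weight-insertAt (removeAt u i) i (lookup u i))

count-removeAt : ∀ (u : Vec (Fin k) (suc n)) i j →
                 count u j ≡ hit (lookup u i) j + count (removeAt u i) j
count-removeAt u i j =
  trans (cong (λ v → count v j) (sym (Vecₚ.insertAt-removeAt u i))) (count-insertAt (removeAt u i) i (lookup u i) j)

count-removeAt-lookup : ∀ (u : Vec (Fin k) (suc n)) i →
                        count u (lookup u i) ≡ suc (count (removeAt u i) (lookup u i))
count-removeAt-lookup u i = trans (count-removeAt u i (lookup u i)) (cong (_+ count (removeAt u i) (lookup u i)) (hit-refl (lookup u i)))

count-zero⊎occurs : ∀ (x : Vec (Fin k) n) d → count x d ≡ 0 ⊎ ∃ λ i → lookup x i ≡ d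
count-zero⊎occurs []      d = inj₁ refl
count-zero⊎occurs (c ∷ x) d with c Fin.≟ d
... | yes c≡d = inj₂ (zero , c≡d)
... | no  c≢d with count-zero⊎occurs x d
...   | inj₁ ≡0        = inj₁ (cong₂ _+_ (hit-≢ c≢d) ≡0)
...   | inj₂ (i , eq) = inj₂ (suc i , eq)

∑-count : ∀ (x : Vec (Fin k) n) → ∑ (allFin k) (count x) ≡ n
∑-count {k} {n} x = begin
  ∑ (allFin k) (count x)               ≡⟨ ∑-cong (allFin k) (λ c → sym (ℕₚ.*-identityʳ (count x c))) ⟩
  ∑[ c ∈ allFin k ] (count x c * 1)    ≡⟨ ∑-lookup x (λ _ → 1) ⟨
  ∑[ i ∈ allFin n ] 1                  ≡⟨ ∑-allFin-const n 1 ⟩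
  n * 1                                ≡⟨ ℕₚ.*-identityʳ n ⟩
  n                                    ∎
  where open ≡-Reasoning

𝟙 : Bool → ℕ
𝟙 b = if b then 1 else 0

𝟙-cong : ∀ {a b} → (T a → T b) → (T b → T a) → 𝟙 a ≡ 𝟙 b
𝟙-cong {true}  {true}  _ _ = refl
𝟙-cong {true}  {false} f _ = contradiction (f tt) λ ()
𝟙-cong {false} {true}  _ g = contradiction (g tt) λ ()
𝟙-cong {false} {false} _ _ = refl

𝟙-¬T : ∀ {a} → ¬ T a → 𝟙 a ≡ 0
𝟙-¬T ¬a = 𝟙-cong {b = false} ¬a (λ ())

length-filterᵇ : ∀ (p : A → Bool) xs → length (filterᵇ p xs) ≡ ∑[ x ∈ xs ] 𝟙 (p x)
length-filterᵇ p []       = refl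
length-filterᵇ p (x ∷ xs) with p x
... | true  = cong suc (length-filterᵇ p xs)
... | false = length-filterᵇ p xs

≡ᵛ⇒≡ : ∀ (a b : Vec ℕ k) → T (a ≡ᵛ b) → a ≡ b
≡ᵛ⇒≡ []      []      _ = refl
≡ᵛ⇒≡ (a ∷ u) (b ∷ v) t with Equivalence.to T-∧ t
... | a≡b , u≡v = cong₂ _∷_ (ℕₚ.≡ᵇ⇒≡ a b a≡b) (≡ᵛ⇒≡ u v u≡v)

≡ᵛ-refl : ∀ (a : Vec ℕ k) → T (a ≡ᵛ a)
≡ᵛ-refl []      = tt
≡ᵛ-refl (a ∷ u) = Equivalence.from T-∧ (ℕₚ.≡⇒≡ᵇ a a refl , ≡ᵛ-refl u)

sameSlice⇒count : ∀ {m} (x : Vec (Fin k) m) (y : Vec (Fin k) n) →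
                  T (sliceOf x ≡ᵛ sliceOf y) → ∀ c → count x c ≡ count y c
sameSlice⇒count x y t c = begin
  count x c             ≡⟨ Vecₚ.lookup∘tabulate (count x) c ⟨
  lookup (sliceOf x) c  ≡⟨ cong (λ s → lookup s c) (≡ᵛ⇒≡ (sliceOf x) (sliceOf y) t) ⟩
  lookup (sliceOf y) c  ≡⟨ Vecₚ.lookup∘tabulate (count y) c ⟩
  count y c             ∎
  where open ≡-Reasoning

count⇒sameSlice : ∀ {m} (x : Vec (Fin k) m) (y : Vec (Fin k) n) →
                  (∀ c → count x c ≡ count y c) → T (sliceOf x ≡ᵛ sliceOf y)
count⇒sameSlice x y eq = subst (λ s → T (sliceOf x ≡ᵛ s)) (Vecₚ.tabulate-cong eq) (≡ᵛ-refl (sliceOf x))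

sliceSize≡∑ : ∀ (x : Vec (Fin k) n) →
              sliceSize x ≡ ∑[ y ∈ allPoints k n ] 𝟙 (sliceOf y ≡ᵛ sliceOf x)
sliceSize≡∑ {k} {n} x = length-filterᵇ _ (allPoints k n)

-- The slice size is a multinomial coefficient. The slice of `u` is sorted by first letter `d`: the
-- points beginning with `d` correspond to the slice of `u` with one `d` removed, so by induction
-- they contribute `n !` times `count u d`, and the counts add up to `suc n`.
sliceSize*weight : ∀ (x : Vec (Fin k) n) → sliceSize x * weight x ≡ n !
sliceSize*weight {k} {zero} [] = begin
  sliceSize {k} [] * 1                        ≡⟨ ℕₚ.*-identityʳ (sliceSize {k} []) ⟩
  sliceSize {k} []                            ≡⟨ sliceSize≡∑ {k} [] ⟩
  𝟙 (sliceOf {k} [] ≡ᵛ sliceOf {k} []) + 0    ≡⟨ cong (_+ 0) (𝟙-cong {b = true} (λ _ → tt) (λ _ → ≡ᵛ-refl (sliceOf {k} []))) ⟩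
  1                                           ∎
  where open ≡-Reasoning
sliceSize*weight {k} {suc n} u = begin
  sliceSize u * weight u
    ≡⟨ ℕₚ.*-comm (sliceSize u) (weight u) ⟩
  weight u * sliceSize u
    ≡⟨ cong (weight u *_) (trans (sliceSize≡∑ u) (∑-allPoints (λ y → 𝟙 (sliceOf y ≡ᵛ sliceOf u)))) ⟩
  weight u * ∑ (allFin k) startingWith
    ≡⟨ ∑-*ˡ (allFin k) (weight u) startingWith ⟨
  ∑[ d ∈ allFin k ] (weight u * startingWith d)
    ≡⟨ ∑-cong (allFin k) startingWith-weight ⟩
  ∑[ d ∈ allFin k ] (n ! * count u d)
    ≡⟨ ∑-*ˡ (allFin k) (n !) (count u) ⟩
  n ! * ∑ (allFin k) (count u)
    ≡⟨ cong (n ! *_) (∑-count u) ⟩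
  n ! * suc n
    ≡⟨ ℕₚ.*-comm (n !) (suc n) ⟩
  suc n ! ∎
  where
  open ≡-Reasoning

  startingWith : Fin k → ℕ
  startingWith d = ∑[ y ∈ allPoints k n ] 𝟙 (sliceOf (d ∷ y) ≡ᵛ sliceOf u)

  rearrange : ∀ w s c → w * suc c * s ≡ s * w * suc c
  rearrange = solve-∀

  startingWith-weight : ∀ d → weight u * startingWith d ≡ n ! * count u d
  startingWith-weight d with count-zero⊎occurs u d
  -- A letter missing from `u` begins no point of its slice, so both sides vanish.
  ... | inj₁ ≡0 = begin
    weight u * startingWith d                ≡⟨ cong (weight u *_) (∑-cong (allPoints k n) λ y → 𝟙-¬T (absent y)) ⟩
    weight u * (∑[ y ∈ allPoints k n ] 0)    ≡⟨ cong (weight u *_) (∑-zero (allPoints k n)) ⟩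
    weight u * 0                             ≡⟨ trans (ℕₚ.*-zeroʳ (weight u)) (sym (ℕₚ.*-zeroʳ (n !))) ⟩
    n ! * 0                                  ≡⟨ cong (n ! *_) ≡0 ⟨
    n ! * count u d                          ∎
    where
    absent : ∀ y → ¬ T (sliceOf (d ∷ y) ≡ᵛ sliceOf u)
    absent y t with trans (cong (_+ count y d) (sym (hit-refl d))) (trans (sameSlice⇒count (d ∷ y) u t d) ≡0)
    ... | ()
  -- Any occurrence `i` of `d` may be deleted, because the slice of the remainder `r` depends only
  -- on its counts.
  ... | inj₂ (i , refl) = begin
    weight u * startingWith d
      ≡⟨ cong₂ _*_ (weight-removeAt u i) (∑-cong (allPoints k n) λ y → 𝟙-cong (cancel y) (extend y)) ⟩
    weight r * suc (count r d) * (∑[ y ∈ allPoints k n ] 𝟙 (sliceOf y ≡ᵛ sliceOf r))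
      ≡⟨ cong (weight r * suc (count r d) *_) (sliceSize≡∑ r) ⟨
    weight r * suc (count r d) * sliceSize r
      ≡⟨ rearrange (weight r) (sliceSize r) (count r d) ⟩
    sliceSize r * weight r * suc (count r d)
      ≡⟨ cong₂ _*_ (sliceSize*weight r) (sym (count-removeAt-lookup u i)) ⟩
    n ! * count u d ∎
    where
    r : Vec (Fin k) n
    r = removeAt u i
    cancel : ∀ y → T (sliceOf (d ∷ y) ≡ᵛ sliceOf u) → T (sliceOf y ≡ᵛ sliceOf r)
    cancel y t = count⇒sameSlice y r λ c →
      ℕₚ.+-cancelˡ-≡ (hit d c) _ _ (trans (sameSlice⇒count (d ∷ y) u t c) (count-removeAt u i c))
    extend : ∀ y → T (sliceOf y ≡ᵛ sliceOf r) → T (sliceOf (d ∷ y) ≡ᵛ sliceOf u)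
    extend y t = count⇒sameSlice (d ∷ y) u λ c →
      trans (cong (hit d c +_) (sameSlice⇒count y r t c)) (sym (count-removeAt u i c))

-- Counting compositions.

#compositions : ℕ → ℕ → ℕ
#compositions k n = length (compositions k n)

length-concatMap : ∀ (xs : List A) (g : A → List B) → length (concatMap g xs) ≡ ∑[ x ∈ xs ] length (g x)
length-concatMap []       g = refl
length-concatMap (x ∷ xs) g =
  trans (Listₚ.length-++ (g x)) (cong (length (g x) +_) (length-concatMap xs g))

#compositions-suc : ∀ k n → #compositions (suc k) n ≡ ∑[ i ∈ upTo (suc n) ] #compositions k (n ∸ i)
#compositions-suc k n = trans (length-concatMap (upTo (suc n)) (λ i → map (i ∷_) (compositions k (n ∸ i))))
  (∑-cong (upTo (suc n)) λ i → Listₚ.length-map (i ∷_) (compositions k (n ∸ i)))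

#compositions-zero : ∀ k → #compositions k 0 ≡ 1
#compositions-zero zero    = refl
#compositions-zero (suc k) = trans (#compositions-suc k 0) (trans (ℕₚ.+-identityʳ _) (#compositions-zero k))

-- The first part is either zero, leaving a composition with one part fewer, or positive, and then
-- it can be lowered by one.
#compositions-pascal : ∀ k n →
  #compositions (suc k) (suc n) ≡ #compositions k (suc n) + #compositions (suc k) n
#compositions-pascal k n = begin
  #compositions (suc k) (suc n)
    ≡⟨ #compositions-suc k (suc n) ⟩
  #compositions k (suc n) + ∑ (applyUpTo suc (suc n)) (λ i → #compositions k (suc n ∸ i))
    ≡⟨ cong (λ is → #compositions k (suc n) + ∑ is (λ i → #compositions k (suc n ∸ i))) (Listₚ.map-upTo suc (suc n)) ⟨
  #compositions k (suc n) + ∑ (map suc (upTo (suc n))) (λ i → #compositions k (suc n ∸ i))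
    ≡⟨ cong (#compositions k (suc n) +_) (∑-map (upTo (suc n)) suc _) ⟩
  #compositions k (suc n) + ∑ (upTo (suc n)) (λ i → #compositions k (n ∸ i))
    ≡⟨ cong (#compositions k (suc n) +_) (#compositions-suc k n) ⟨
  #compositions k (suc n) + #compositions (suc k) n ∎
  where open ≡-Reasoning

-- Stars and bars: the number is a binomial coefficient, written with its denominators on the left
-- to avoid division. The induction is Pascal's rule.
#compositions-! : ∀ k n → #compositions (suc k) n * n ! * k ! ≡ (n + k) !
#compositions-! k zero = begin
  #compositions (suc k) 0 * 1 * k !  ≡⟨ cong (λ c → c * 1 * k !) (#compositions-zero (suc k)) ⟩
  1 * 1 * k !                        ≡⟨ ℕₚ.*-identityˡ (k !) ⟩
  k !                                ∎
  where open ≡-Reasoning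
#compositions-! zero (suc n) = begin
  #compositions 1 (suc n) * suc n ! * 1  ≡⟨ cong (λ c → c * suc n ! * 1) (#compositions-pascal 0 n) ⟩
  #compositions 1 n * suc n ! * 1        ≡⟨ split (#compositions 1 n) (suc n) (n !) ⟩
  suc n * (#compositions 1 n * n ! * 1)  ≡⟨ cong (suc n *_) (#compositions-! zero n) ⟩
  suc n * (n + 0) !                      ≡⟨ cong (λ j → suc n * j !) (ℕₚ.+-identityʳ n) ⟩
  suc n !                                ≡⟨ cong _! (ℕₚ.+-identityʳ (suc n)) ⟨
  (suc n + 0) !                          ∎
  where
  open ≡-Reasoning
  split : ∀ c m f → c * (m * f) * 1 ≡ m * (c * f * 1)
  split = solve-∀
#compositions-! (suc k) (suc n) = begin
  #compositions (suc (suc k)) (suc n) * suc n ! * suc k !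
    ≡⟨ cong (λ c → c * suc n ! * suc k !) (#compositions-pascal (suc k) n) ⟩
  (c₁ + c₂) * (suc n * n !) * (suc k * k !)
    ≡⟨ split c₁ c₂ (suc n) (n !) (suc k) (k !) ⟩
  suc k * (c₁ * suc n ! * k !) + suc n * (c₂ * n ! * suc k !)
    ≡⟨ cong₂ _+_ (cong (suc k *_) (#compositions-! k (suc n))) (cong (suc n *_) (#compositions-! (suc k) n)) ⟩
  suc k * (suc n + k) ! + suc n * (n + suc k) !
    ≡⟨ cong (λ j → suc k * (suc n + k) ! + suc n * j !) (ℕₚ.+-suc n k) ⟩
  suc k * (suc n + k) ! + suc n * (suc n + k) !
    ≡⟨ collect k n ((suc n + k) !) ⟩
  suc (suc n + k) * (suc n + k) !
    ≡⟨ cong _! (ℕₚ.+-suc (suc n) k) ⟨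
  (suc n + suc k) ! ∎
  where
  open ≡-Reasoning
  c₁ = #compositions (suc k) (suc n)
  c₂ = #compositions (suc (suc k)) n
  split : ∀ c d m f l g → (c + d) * (m * f) * (l * g) ≡ l * (c * (m * f) * g) + m * (d * f * (l * g))
  split = solve-∀
  collect : ∀ k n f → suc k * f + suc n * f ≡ suc (suc n + k) * f
  collect = solve-∀

-- The normalising constant of the equal-slices measure: esWeight x = weight x / total k n.
total : ℕ → ℕ → ℕ
total k n = #compositions k n * n !

total-! : ∀ k n → total (suc k) n * k ! ≡ (n + k) !
total-! = #compositions-!

-- By `total-!` the constant is `(n + k) !` over `k !`. The ratio `n + suc k` is also the number of
-- rules for one coordinate over `suc k` letters, which is why averaging over rules preserves
-- densities.
total-suc : ∀ k n → total (suc k) (suc n) ≡ (n + suc k) * total (suc k) n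
total-suc k n = ℕₚ.*-cancelʳ-≡ _ _ (k !) {{k ℕₚ.!≢0}} (begin
  total (suc k) (suc n) * k !          ≡⟨ total-! k (suc n) ⟩
  suc (n + k) * (n + k) !              ≡⟨ cong₂ _*_ (ℕₚ.+-suc n k) (total-! k n) ⟨
  (n + suc k) * (total (suc k) n * k !) ≡⟨ ℕₚ.*-assoc (n + suc k) (total (suc k) n) (k !) ⟨
  (n + suc k) * total (suc k) n * k !  ∎)
  where open ≡-Reasoning

-- Lines are points over an alphabet with one more letter; this compares their normalising constant
-- with that of the points.
total-alphabet-suc : ∀ k n → suc k * total (suc (suc k)) n ≡ (n + suc k) * total (suc k) n
total-alphabet-suc k n = ℕₚ.*-cancelʳ-≡ _ _ (k !) {{k ℕₚ.!≢0}} (begin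
  suc k * total (suc (suc k)) n * k !      ≡⟨ regroup (suc k) (total (suc (suc k)) n) (k !) ⟩
  total (suc (suc k)) n * suc k !          ≡⟨ total-! (suc k) n ⟩
  (n + suc k) !                            ≡⟨ cong _! (ℕₚ.+-suc n k) ⟩
  suc (n + k) * (n + k) !                  ≡⟨ cong₂ _*_ (ℕₚ.+-suc n k) (total-! k n) ⟨
  (n + suc k) * (total (suc k) n * k !)    ≡⟨ ℕₚ.*-assoc (n + suc k) (total (suc k) n) (k !) ⟨
  (n + suc k) * total (suc k) n * k !      ∎)
  where
  open ≡-Reasoning
  regroup : ∀ l t f → l * t * f ≡ t * (l * f)
  regroup = solve-∀

-- Averaging over hyperplanes

𝟙-mono : ∀ {a b} → (T a → T b) → 𝟙 a ℕ.≤ 𝟙 b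
𝟙-mono {false}        _ = z≤n
𝟙-mono {true} {true}  _ = s≤s z≤n
𝟙-mono {true} {false} f = contradiction (f tt) λ ()

allᵇ⁺ : ∀ (p : A → Bool) xs → (∀ x → T (p x)) → T (allᵇ p xs)
allᵇ⁺ p []       h = tt
allᵇ⁺ p (x ∷ xs) h = Equivalence.from T-∧ (h x , allᵇ⁺ p xs h)

allᵇ⁻ : ∀ (p : A → Bool) {x xs} → x ∈ xs → T (allᵇ p xs) → T (p x)
allᵇ⁻ p (here refl)  t = proj₁ (Equivalence.to T-∧ t)
allᵇ⁻ p (there x∈xs) t = allᵇ⁻ p x∈xs (proj₂ (Equivalence.to T-∧ t))

lineIn⁺ : ∀ (S : Subset k n) y → T (anyᵇ isTop y) → (∀ j → T (S (substTop j y))) → T (lineIn S y)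
lineIn⁺ {k} S y top inS = Equivalence.from T-∧ (top , allᵇ⁺ _ (allFin k) inS)

lineIn⁻ : ∀ (S : Subset k n) y → T (lineIn S y) → T (anyᵇ isTop y) × (∀ j → T (S (substTop j y)))
lineIn⁻ S y t with Equivalence.to T-∧ t
... | top , inS = top , λ j → allᵇ⁻ (λ j → S (substTop j y)) (∈-allFin j) inS

replaceTop-fromℕ : ∀ (j : Fin k) → replaceTop j (fromℕ k) ≡ j
replaceTop-fromℕ {k} j with k ℕ.≟ toℕ (fromℕ k)
... | yes _  = refl
... | no  k≢ = contradiction (sym (Finₚ.toℕ-fromℕ k)) k≢

replaceTop-inject₁ : ∀ (j c : Fin k) → replaceTop j (inject₁ c) ≡ c
replaceTop-inject₁ {k} j c with k ℕ.≟ toℕ (inject₁ c)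
... | yes k≡ = contradiction k≡ (Finₚ.toℕ-inject₁-≢ c)
... | no  k≢ = Finₚ.inject₁-injective (Finₚ.inject₁-lower₁ (inject₁ c) k≢)

anyᵇ-insertAt : ∀ (p : A → Bool) (x : Vec A n) i c → T (anyᵇ p x) → T (anyᵇ p (insertAt x i c))
anyᵇ-insertAt p x       zero    c t with p c
... | true  = tt
... | false = t
anyᵇ-insertAt p (d ∷ x) (suc i) c t with p d
... | true  = tt
... | false = anyᵇ-insertAt p x i c t

substTop-insertAt : ∀ (j : Fin k) (z : Vec (Fin (suc k)) n) i c →
                    substTop j (insertAt z i c) ≡ insertAt (substTop j z) i (replaceTop j c)
substTop-insertAt j z i c = Vecₚ.map-insertAt (replaceTop j) c z i

hit-fromℕ : ∀ (c : Fin (suc k)) → hit c (fromℕ k) ≡ 𝟙 (isTop c)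
hit-fromℕ {k} c = cong (λ t → 𝟙 (toℕ c ≡ᵇ t)) (Finₚ.toℕ-fromℕ k)

-- Non-degeneracy enters the averaging through this: the number of wildcards of a line can be
-- cancelled.
anyTop⇒count : ∀ (y : Vec (Fin (suc k)) n) → T (anyᵇ isTop y) → NonZero (count y (fromℕ k))
anyTop⇒count {k} (c ∷ y) t rewrite hit-fromℕ c with isTop c
... | true  = _
... | false = anyTop⇒count y t

-- The numerator of the equal-slices density over `total k n`; it keeps the combinatorial argument
-- within the natural numbers.
mass : Subset k n → ℕ
mass {k} {n} S = ∑[ x ∈ allPoints k n ] (𝟙 (S x) * weight x)

-- A hyperplane of [k]^(n+1) fixes one coordinate to a constant or makes it a copy of another one;
-- a rule computes that coordinate from the n remaining ones.
rules : ∀ k n → List (Vec (Fin k) n → Fin k)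
rules k n = map const (allFin k) ++ map (λ j x → lookup x j) (allFin n)

restrict : Subset k (suc n) → Fin (suc n) → (Vec (Fin k) n → Fin k) → Subset k n
restrict S i r x = S (insertAt x i (r x))

∑-rules : ∀ (g : (Vec (Fin k) n → Fin k) → ℕ) →
          ∑ (rules k n) g ≡ (∑[ c ∈ allFin k ] g (const c)) + (∑[ j ∈ allFin n ] g (λ x → lookup x j))
∑-rules {k} {n} g = trans (∑-++ (map const (allFin k)) (map (λ j x → lookup x j) (allFin n)) g)
  (cong₂ _+_ (∑-map (allFin k) const g) (∑-map (allFin n) (λ j x → lookup x j) g))

∑-rules-const : ∀ k n c → ∑ (rules k n) (λ _ → c) ≡ (n + k) * c
∑-rules-const k n c = begin
  ∑ (rules k n) (λ _ → c)                          ≡⟨ ∑-rules {k} {n} (λ _ → c) ⟩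
  ∑ (allFin k) (λ _ → c) + ∑ (allFin n) (λ _ → c)  ≡⟨ cong₂ _+_ (∑-allFin-const k c) (∑-allFin-const n c) ⟩
  k * c + n * c                                    ≡⟨ swap k n c ⟩
  (n + k) * c                                      ∎
  where
  open ≡-Reasoning
  swap : ∀ k n c → k * c + n * c ≡ (n + k) * c
  swap = solve-∀

∑-copy : ∀ (f : Vec (Fin k) n → Fin k → ℕ) →
         ∑[ j ∈ allFin n ] ∑[ x ∈ allPoints k n ] f x (lookup x j) ≡
         ∑[ x ∈ allPoints k n ] ∑[ c ∈ allFin k ] (count x c * f x c)
∑-copy {k} {n} f = trans (∑-swap (allFin n) (allPoints k n) (λ j x → f x (lookup x j)))
  (∑-cong (allPoints k n) λ x → ∑-lookup x (f x))

-- Pólya's urn: the last coordinate of an equal-slices random point is a fresh constant or a copy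
-- of another coordinate, all choices being equally likely.
∑-mass-restrict : ∀ (S : Subset k (suc n)) i → ∑[ r ∈ rules k n ] mass (restrict S i r) ≡ mass S
∑-mass-restrict {k} {n} S i = begin
  ∑[ r ∈ rules k n ] mass (restrict S i r)
    ≡⟨ ∑-rules (λ r → mass (restrict S i r)) ⟩
  (∑[ c ∈ allFin k ] ∑[ x ∈ allPoints k n ] f x c) + (∑[ j ∈ allFin n ] ∑[ x ∈ allPoints k n ] f x (lookup x j))
    ≡⟨ cong₂ _+_ (∑-swap (allFin k) (allPoints k n) (λ c x → f x c)) (∑-copy f) ⟩
  (∑[ x ∈ allPoints k n ] ∑[ c ∈ allFin k ] f x c) + (∑[ x ∈ allPoints k n ] ∑[ c ∈ allFin k ] (count x c * f x c))
    ≡⟨ ∑-+ (allPoints k n) (λ x → ∑[ c ∈ allFin k ] f x c) (λ x → ∑[ c ∈ allFin k ] (count x c * f x c)) ⟨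
  ∑[ x ∈ allPoints k n ] ((∑[ c ∈ allFin k ] f x c) + (∑[ c ∈ allFin k ] (count x c * f x c)))
    ≡⟨ ∑-cong (allPoints k n) (λ x → trans (sym (∑-+ (allFin k) (f x) (λ c → count x c * f x c))) (∑-cong (allFin k) (pointwise x))) ⟩
  ∑[ x ∈ allPoints k n ] ∑[ c ∈ allFin k ] (𝟙 (S (insertAt x i c)) * weight (insertAt x i c))
    ≡⟨ ∑-insertAt i (λ u → 𝟙 (S u) * weight u) ⟨
  mass S ∎
  where
  open ≡-Reasoning
  f : Vec (Fin k) n → Fin k → ℕ
  f x c = 𝟙 (S (insertAt x i c)) * weight x
  collect : ∀ a w c → a * w + c * (a * w) ≡ a * (w * suc c)
  collect = solve-∀
  pointwise : ∀ x c → f x c + count x c * f x c ≡ 𝟙 (S (insertAt x i c)) * weight (insertAt x i c)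
  pointwise x c rewrite weight-insertAt x i c = collect (𝟙 (S (insertAt x i c))) (weight x) (count x c)

-- A constant rule fixes one of the `k` letters, so a new wildcard can arise by copying but never as
-- a constant. This 0/1 factor lets constants and copies be summed over the same `suc k` letters.
nonTop : Fin (suc k) → ℕ
nonTop {k} c = 1 ∸ hit c (fromℕ k)

∑-inject₁ : ∀ (h : Fin (suc k) → ℕ) → ∑[ c ∈ allFin k ] h (inject₁ c) ≡ ∑[ c ∈ allFin (suc k) ] (nonTop c * h c)
∑-inject₁ {zero}  h = refl
∑-inject₁ {suc k} h = begin
  ∑[ c ∈ allFin (suc k) ] h (inject₁ c)
    ≡⟨ ∑-allFin (h ∘ inject₁) ⟩
  h zero + (∑[ c ∈ allFin k ] h (suc (inject₁ c)))
    ≡⟨ cong₂ _+_ (sym (ℕₚ.+-identityʳ (h zero))) (∑-inject₁ (h ∘ suc)) ⟩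
  (h zero + 0) + (∑[ c ∈ allFin (suc k) ] (nonTop c * h (suc c)))
    ≡⟨ ∑-allFin (λ c → nonTop c * h c) ⟨
  ∑[ c ∈ allFin (suc (suc k)) ] (nonTop c * h c) ∎
  where open ≡-Reasoning

∑-hit-lookup : ∀ (x : Vec (Fin k) n) d → ∑[ i ∈ allFin n ] hit (lookup x i) d ≡ count x d
∑-hit-lookup []      d = refl
∑-hit-lookup (c ∷ x) d = trans (∑-allFin (λ i → hit (lookup (c ∷ x) i) d)) (cong (hit c d +_) (∑-hit-lookup x d))

-- The inserted letter is not the wildcard, so it stays fixed along the lifted line.
liftConst : ∀ (S : Subset k (suc n)) i c z →
            T (lineIn (restrict S i (const c)) z) → T (lineIn S (insertAt z i (inject₁ c)))
liftConst S i c z t with lineIn⁻ (restrict S i (const c)) z t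
... | top , inS = lineIn⁺ S _ (anyᵇ-insertAt isTop z i (inject₁ c) top) λ j →
  subst (T ∘ S) (sym (trans (substTop-insertAt j z i (inject₁ c)) (cong (insertAt (substTop j z) i) (replaceTop-inject₁ j c)))) (inS j)

-- Replacing wildcards commutes with copying: a copied wildcard is again a wildcard and moves with
-- its original.
liftCopy : ∀ (S : Subset k (suc n)) i l z →
           T (lineIn (restrict S i (λ x → lookup x l)) z) → T (lineIn S (insertAt z i (lookup z l)))
liftCopy S i l z t with lineIn⁻ (restrict S i (λ x → lookup x l)) z t
... | top , inS = lineIn⁺ S _ (anyᵇ-insertAt isTop z i (lookup z l) top) λ j →
  subst (T ∘ S) (sym (trans (substTop-insertAt j z i (lookup z l)) (cong (insertAt (substTop j z) i) (sym (Vecₚ.lookup-map l (replaceTop j) z))))) (inS j)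

-- The weight that u inherits from the lines of all hyperplanes that express coordinate i.
inherited : Vec (Fin (suc k)) (suc n) → Fin (suc n) → ℕ
inherited u i = (nonTop (lookup u i) + count (removeAt u i) (lookup u i)) * weight (removeAt u i)

-- With `a` wildcards in `u`, the inherited weight is the full weight of `u` if coordinate `i` is
-- not a wildcard, and the fraction (a - 1)/a of it otherwise. Multiplying by `a` clears the
-- fraction and makes both cases one equation.
inherited-weight : ∀ (u : Vec (Fin (suc k)) (suc n)) i →
  count u (fromℕ k) * inherited u i + weight u * hit (lookup u i) (fromℕ k) ≡ count u (fromℕ k) * weight u
inherited-weight {k} u i with lookup u i Fin.≟ fromℕ k
... | yes eq rewrite weight-removeAt u i | count-removeAt u i (fromℕ k) | eq | hit-refl (fromℕ k) =
  collect (count (removeAt u i) (fromℕ k)) (weight (removeAt u i))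
  where
  collect : ∀ c w → suc c * (c * w) + w * suc c * 1 ≡ suc c * (w * suc c)
  collect = solve-∀
... | no ≢top rewrite weight-removeAt u i | hit-≢ ≢top =
  collect (count u (fromℕ k)) (count (removeAt u i) (lookup u i)) (weight (removeAt u i))
  where
  collect : ∀ a c w → a * (suc c * w) + w * suc c * 0 ≡ a * (w * suc c)
  collect = solve-∀

-- The n + 1 - a coordinates that are not wildcards contribute the full weight each, and the `a`
-- wildcards together contribute a - 1 times the weight. The total factor is `n`, whatever `a` is.
∑-inherited : ∀ (u : Vec (Fin (suc k)) (suc n)) → .{{NonZero (count u (fromℕ k))}} →
              ∑ (allFin (suc n)) (inherited u) ≡ n * weight u
∑-inherited {k} {n} u = ℕₚ.*-cancelˡ-≡ _ _ a (ℕₚ.+-cancelʳ-≡ (weight u * a) _ _ (begin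
  a * ∑ (allFin (suc n)) (inherited u) + weight u * a
    ≡⟨ cong₂ _+_ (∑-*ˡ (allFin (suc n)) a (inherited u))
         (trans (∑-*ˡ (allFin (suc n)) (weight u) (λ i → hit (lookup u i) (fromℕ k))) (cong (weight u *_) (∑-hit-lookup u (fromℕ k)))) ⟨
  (∑[ i ∈ allFin (suc n) ] (a * inherited u i)) + (∑[ i ∈ allFin (suc n) ] (weight u * hit (lookup u i) (fromℕ k)))
    ≡⟨ ∑-+ (allFin (suc n)) (λ i → a * inherited u i) (λ i → weight u * hit (lookup u i) (fromℕ k)) ⟨
  ∑[ i ∈ allFin (suc n) ] (a * inherited u i + weight u * hit (lookup u i) (fromℕ k))
    ≡⟨ ∑-cong (allFin (suc n)) (inherited-weight u) ⟩
  ∑[ i ∈ allFin (suc n) ] (a * weight u)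
    ≡⟨ ∑-allFin-const (suc n) (a * weight u) ⟩
  suc n * (a * weight u)
    ≡⟨ collect a n (weight u) ⟩
  a * (n * weight u) + weight u * a ∎))
  where
  open ≡-Reasoning
  a = count u (fromℕ k)
  collect : ∀ a n w → suc n * (a * w) ≡ a * (n * w) + w * a
  collect = solve-∀

-- Lines of the hyperplanes are lifted to lines `u` of the whole cube and grouped by `u`. Such a `u`
-- is reached from the constant rule when its letter at `i` is not the wildcard, and once from each
-- other coordinate with the same letter.
∑-rules-mass-linesIn : ∀ (S : Subset k (suc n)) i →
  ∑[ r ∈ rules k n ] mass (linesIn (restrict S i r)) ℕ.≤
  ∑[ u ∈ allPoints (suc k) (suc n) ] (𝟙 (lineIn S u) * inherited u i)
∑-rules-mass-linesIn {k} {n} S i = begin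
  ∑[ r ∈ rules k n ] mass (linesIn (restrict S i r))
    ≡⟨ ∑-rules (λ r → mass (linesIn (restrict S i r))) ⟩
  (∑[ c ∈ allFin k ] mass (linesIn (restrict S i (const c)))) + (∑[ l ∈ allFin n ] mass (linesIn (restrict S i (λ x → lookup x l))))
    ≤⟨ ℕₚ.+-mono-≤
         (∑-mono (allFin k) λ c → ∑-mono P λ z → ℕₚ.*-monoˡ-≤ (weight z) (𝟙-mono (liftConst S i c z)))
         (∑-mono (allFin n) λ l → ∑-mono P λ z → ℕₚ.*-monoˡ-≤ (weight z) (𝟙-mono (liftCopy S i l z))) ⟩
  (∑[ c ∈ allFin k ] ∑[ z ∈ P ] f z (inject₁ c)) + (∑[ l ∈ allFin n ] ∑[ z ∈ P ] f z (lookup z l))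
    ≡⟨ cong₂ _+_
         (trans (∑-swap (allFin k) P (λ c z → f z (inject₁ c))) (∑-cong P λ z → ∑-inject₁ (f z)))
         (∑-copy f) ⟩
  (∑[ z ∈ P ] ∑[ c ∈ C ] (nonTop c * f z c)) + (∑[ z ∈ P ] ∑[ c ∈ C ] (count z c * f z c))
    ≡⟨ ∑-+ P (λ z → ∑[ c ∈ C ] (nonTop c * f z c)) (λ z → ∑[ c ∈ C ] (count z c * f z c)) ⟨
  ∑[ z ∈ P ] ((∑[ c ∈ C ] (nonTop c * f z c)) + (∑[ c ∈ C ] (count z c * f z c)))
    ≡⟨ ∑-cong P (λ z → trans (sym (∑-+ C (λ c → nonTop c * f z c) (λ c → count z c * f z c))) (∑-cong C (pointwise z))) ⟩
  ∑[ z ∈ P ] ∑[ c ∈ C ] (𝟙 (lineIn S (insertAt z i c)) * inherited (insertAt z i c) i)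
    ≡⟨ ∑-insertAt i (λ u → 𝟙 (lineIn S u) * inherited u i) ⟨
  ∑[ u ∈ allPoints (suc k) (suc n) ] (𝟙 (lineIn S u) * inherited u i) ∎
  where
  open ℕₚ.≤-Reasoning
  P = allPoints (suc k) n
  C = allFin (suc k)
  f : Vec (Fin (suc k)) n → Fin (suc k) → ℕ
  f z c = 𝟙 (lineIn S (insertAt z i c)) * weight z
  collect : ∀ t c a w → t * (a * w) + c * (a * w) ≡ a * ((t + c) * w)
  collect = solve-∀
  pointwise : ∀ z c → nonTop c * f z c + count z c * f z c ≡ 𝟙 (lineIn S (insertAt z i c)) * inherited (insertAt z i c) i
  pointwise z c rewrite Vecₚ.removeAt-insertAt z i c | Vecₚ.insertAt-lookup z i c =
    collect (nonTop c) (count z c) (𝟙 (lineIn S (insertAt z i c))) (weight z)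

∑-mass-linesIn-restrict : ∀ (S : Subset k (suc n)) →
  ∑[ i ∈ allFin (suc n) ] ∑[ r ∈ rules k n ] mass (linesIn (restrict S i r)) ℕ.≤ n * mass (linesIn S)
∑-mass-linesIn-restrict {k} {n} S = begin
  ∑[ i ∈ allFin (suc n) ] ∑[ r ∈ rules k n ] mass (linesIn (restrict S i r))
    ≤⟨ ∑-mono (allFin (suc n)) (∑-rules-mass-linesIn S) ⟩
  ∑[ i ∈ allFin (suc n) ] ∑[ u ∈ P ] (𝟙 (lineIn S u) * inherited u i)
    ≡⟨ ∑-swap (allFin (suc n)) P (λ i u → 𝟙 (lineIn S u) * inherited u i) ⟩
  ∑[ u ∈ P ] ∑[ i ∈ allFin (suc n) ] (𝟙 (lineIn S u) * inherited u i)
    ≡⟨ ∑-cong P pointwise ⟩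
  ∑[ u ∈ P ] (n * (𝟙 (lineIn S u) * weight u))
    ≡⟨ ∑-*ˡ P n (λ u → 𝟙 (lineIn S u) * weight u) ⟩
  n * mass (linesIn S) ∎
  where
  open ℕₚ.≤-Reasoning
  P = allPoints (suc k) (suc n)
  pointwise : ∀ u → ∑[ i ∈ allFin (suc n) ] (𝟙 (lineIn S u) * inherited u i) ≡ n * (𝟙 (lineIn S u) * weight u)
  pointwise u with lineIn S u in eq
  ... | false = trans (∑-zero (allFin (suc n))) (sym (ℕₚ.*-zeroʳ n))
  -- Only here is `∑-inherited` applicable: `u` is a genuine line, so it has a wildcard.
  ... | true  = trans (∑-*ˡ (allFin (suc n)) 1 (inherited u)) (trans (ℕₚ.*-identityˡ _)
    (trans (∑-inherited u {{anyTop⇒count u (proj₁ (lineIn⁻ S u (subst T (sym eq) tt)))}})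
           (cong (n *_) (sym (ℕₚ.*-identityˡ (weight u))))))

-- Deleting a point from every line

∈-allPoints : ∀ (x : Vec (Fin k) n) → x ∈ allPoints k n
∈-allPoints []      = here refl
∈-allPoints {k} {suc n} (c ∷ x) =
  ∈-concatMap⁺ (λ d → map (d ∷_) (allPoints k n)) (lose (∈-allFin c) (∈-map⁺ (c ∷_) (∈-allPoints x)))

_≟ᵛ_ : (x y : Vec (Fin k) n) → Dec (x ≡ y)
_≟ᵛ_ = Vecₚ.≡-dec Fin._≟_

-- Equality of points as a product over coordinates, so that sums against it factor one coordinate
-- at a time.
kronecker : Vec (Fin k) n → Vec (Fin k) n → ℕ
kronecker []      []      = 1
kronecker (c ∷ x) (d ∷ y) = hit c d * kronecker x y

kronecker-refl : ∀ (x : Vec (Fin k) n) → kronecker x x ≡ 1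
kronecker-refl []      = refl
kronecker-refl (c ∷ x) rewrite hit-refl c | kronecker-refl x = refl

∑-kronecker : ∀ (x : Vec (Fin k) n) (f : Vec (Fin k) n → ℕ) → ∑[ y ∈ allPoints k n ] (kronecker x y * f y) ≡ f x
∑-kronecker []      f = trans (ℕₚ.+-identityʳ _) (ℕₚ.*-identityˡ (f []))
∑-kronecker {k} {suc n} (c ∷ x) f = begin
  ∑[ y ∈ allPoints k (suc n) ] (kronecker (c ∷ x) y * f y)
    ≡⟨ ∑-allPoints (λ y → kronecker (c ∷ x) y * f y) ⟩
  ∑[ d ∈ allFin k ] ∑[ y ∈ allPoints k n ] (hit c d * kronecker x y * f (d ∷ y))
    ≡⟨ ∑-cong (allFin k) (λ d → trans
         (∑-cong (allPoints k n) λ y → ℕₚ.*-assoc (hit c d) (kronecker x y) (f (d ∷ y)))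
         (trans (∑-*ˡ (allPoints k n) (hit c d) (λ y → kronecker x y * f (d ∷ y)))
                (cong (hit c d *_) (∑-kronecker x (f ∘ (d ∷_)))))) ⟩
  ∑[ d ∈ allFin k ] (hit c d * f (d ∷ x))
    ≡⟨ ∑-hit c (λ d → f (d ∷ x)) ⟩
  f (c ∷ x) ∎
  where open ≡-Reasoning

isLinePoint : Subset k n → Fin k → Vec (Fin k) n → Bool
isLinePoint {k} {n} S j x = any (λ z → lineIn S z ∧ does (substTop j z ≟ᵛ x)) (allPoints (suc k) n)

prune : Fin k → Subset k n → Subset k n
prune j S x = S x ∧ not (isLinePoint S j x)

isLinePoint-substTop : ∀ (S : Subset k n) j z → T (lineIn S z) → T (isLinePoint S j (substTop j z))
isLinePoint-substTop {k} {n} S j z t = any⁺ _ (lose (∈-allPoints z)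
  (Equivalence.from T-∧ (t , Equivalence.from T-≡ (dec-true (substTop j z ≟ᵛ substTop j z) refl))))

T-not : ∀ {b} → T (not b) → ¬ T b
T-not {false} _ ()
T-not {true}  ()

-- A line inside the pruned set is also a line inside `S`, hence its point at `j` has been deleted.
prune-lineFree : ∀ (S : Subset k n) j → ¬ ContainsLine (prune j S)
prune-lineFree S j (z , eq) with lineIn⁻ (prune j S) z (Equivalence.from T-≡ eq)
... | top , inP = T-not (proj₂ (Equivalence.to T-∧ (inP j)))
  (isLinePoint-substTop S j z (lineIn⁺ S z top λ l → proj₁ (Equivalence.to T-∧ (inP l))))

𝟙-∧-not : ∀ a b → 𝟙 a ℕ.≤ 𝟙 (a ∧ not b) + 𝟙 b
𝟙-∧-not false b     = z≤n
𝟙-∧-not true  false = ℕₚ.≤-refl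
𝟙-∧-not true  true  = ℕₚ.≤-refl

𝟙-any : ∀ (p : A → Bool) xs → 𝟙 (any p xs) ℕ.≤ ∑[ x ∈ xs ] 𝟙 (p x)
𝟙-any p []       = z≤n
𝟙-any p (x ∷ xs) with p x
... | true  = s≤s z≤n
... | false = 𝟙-any p xs

𝟙-∧-≟ : ∀ a (x y : Vec (Fin k) n) → 𝟙 (a ∧ does (x ≟ᵛ y)) ℕ.≤ 𝟙 a * kronecker x y
𝟙-∧-≟ false x y = z≤n
𝟙-∧-≟ true  x y with x ≟ᵛ y
... | yes refl = ℕₚ.≤-reflexive (sym (trans (ℕₚ.+-identityʳ _) (kronecker-refl x)))
... | no  _    = z≤n

-- A union bound: each deleted point is charged to every line that has it as its point at `j`.
mass-prune : ∀ (S : Subset k n) j →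
  mass S ℕ.≤ mass (prune j S) + (∑[ z ∈ allPoints (suc k) n ] (𝟙 (lineIn S z) * weight (substTop j z)))
mass-prune {k} {n} S j = begin
  ∑[ x ∈ P ] (𝟙 (S x) * weight x)
    ≤⟨ ∑-mono P pointwise ⟩
  ∑[ x ∈ P ] (𝟙 (prune j S x) * weight x + (∑[ z ∈ L ] (𝟙 (lineIn S z) * (kronecker (substTop j z) x * weight x))))
    ≡⟨ ∑-+ P (λ x → 𝟙 (prune j S x) * weight x) (λ x → ∑[ z ∈ L ] (𝟙 (lineIn S z) * (kronecker (substTop j z) x * weight x))) ⟩
  mass (prune j S) + (∑[ x ∈ P ] ∑[ z ∈ L ] (𝟙 (lineIn S z) * (kronecker (substTop j z) x * weight x)))
    ≡⟨ cong (mass (prune j S) +_) (∑-swap P L (λ x z → 𝟙 (lineIn S z) * (kronecker (substTop j z) x * weight x))) ⟩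
  mass (prune j S) + (∑[ z ∈ L ] ∑[ x ∈ P ] (𝟙 (lineIn S z) * (kronecker (substTop j z) x * weight x)))
    ≡⟨ cong (mass (prune j S) +_) (∑-cong L λ z → trans
         (∑-*ˡ P (𝟙 (lineIn S z)) (λ x → kronecker (substTop j z) x * weight x))
         (cong (𝟙 (lineIn S z) *_) (∑-kronecker (substTop j z) weight))) ⟩
  mass (prune j S) + (∑[ z ∈ L ] (𝟙 (lineIn S z) * weight (substTop j z))) ∎
  where
  open ℕₚ.≤-Reasoning
  P = allPoints k n
  L = allPoints (suc k) n
  right-comm : ∀ w a d → w * (a * d) ≡ a * (d * w)
  right-comm = solve-∀
  pointwise : ∀ x → 𝟙 (S x) * weight x ℕ.≤
    𝟙 (prune j S x) * weight x + (∑[ z ∈ L ] (𝟙 (lineIn S z) * (kronecker (substTop j z) x * weight x)))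
  pointwise x = begin
    𝟙 (S x) * weight x
      ≤⟨ ℕₚ.*-monoˡ-≤ (weight x) (𝟙-∧-not (S x) (isLinePoint S j x)) ⟩
    (𝟙 (prune j S x) + 𝟙 (isLinePoint S j x)) * weight x
      ≡⟨ ℕₚ.*-distribʳ-+ (weight x) (𝟙 (prune j S x)) (𝟙 (isLinePoint S j x)) ⟩
    𝟙 (prune j S x) * weight x + 𝟙 (isLinePoint S j x) * weight x
      ≤⟨ ℕₚ.+-monoʳ-≤ (𝟙 (prune j S x) * weight x) (begin
        𝟙 (isLinePoint S j x) * weight x
          ≤⟨ ℕₚ.*-monoˡ-≤ (weight x) (𝟙-any _ L) ⟩
        (∑[ z ∈ L ] 𝟙 (lineIn S z ∧ does (substTop j z ≟ᵛ x))) * weight x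
          ≤⟨ ℕₚ.*-monoˡ-≤ (weight x) (∑-mono L λ z → 𝟙-∧-≟ (lineIn S z) (substTop j z) x) ⟩
        (∑[ z ∈ L ] (𝟙 (lineIn S z) * kronecker (substTop j z) x)) * weight x
          ≡⟨ ℕₚ.*-comm (∑[ z ∈ L ] (𝟙 (lineIn S z) * kronecker (substTop j z) x)) (weight x) ⟩
        weight x * (∑[ z ∈ L ] (𝟙 (lineIn S z) * kronecker (substTop j z) x))
          ≡⟨ ∑-*ˡ L (weight x) (λ z → 𝟙 (lineIn S z) * kronecker (substTop j z) x) ⟨
        ∑[ z ∈ L ] (weight x * (𝟙 (lineIn S z) * kronecker (substTop j z) x))
          ≡⟨ ∑-cong L (λ z → right-comm (weight x) (𝟙 (lineIn S z)) (kronecker (substTop j z) x)) ⟩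
        ∑[ z ∈ L ] (𝟙 (lineIn S z) * (kronecker (substTop j z) x * weight x)) ∎) ⟩
    𝟙 (prune j S x) * weight x + (∑[ z ∈ L ] (𝟙 (lineIn S z) * (kronecker (substTop j z) x * weight x))) ∎

-- C(a+b, a) ≤ 2^(a+b)
[a+b]!≤a!*b!*2^[a+b] : ∀ a b → (a + b) ! ℕ.≤ a ! * b ! * 2 ^ (a + b)
[a+b]!≤a!*b!*2^[a+b] zero b = begin
  b !                ≡⟨ ℕₚ.*-identityʳ (b !) ⟨
  b ! * 1            ≤⟨ ℕₚ.*-mono-≤ (ℕₚ.≤-reflexive (sym (ℕₚ.*-identityˡ (b !)))) (ℕₚ.m^n>0 2 b) ⟩
  1 * b ! * 2 ^ b    ∎
  where open ℕₚ.≤-Reasoning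
[a+b]!≤a!*b!*2^[a+b] (suc a) zero = begin
  (suc a + 0) !                    ≡⟨ cong _! (ℕₚ.+-identityʳ (suc a)) ⟩
  suc a !                          ≡⟨ trans (sym (ℕₚ.*-identityʳ (suc a !))) (sym (ℕₚ.*-identityʳ (suc a ! * 1))) ⟩
  suc a ! * 1 * 1                  ≤⟨ ℕₚ.*-monoʳ-≤ (suc a ! * 1) (ℕₚ.m^n>0 2 (suc a + 0)) ⟩
  suc a ! * 1 * 2 ^ (suc a + 0)    ∎
  where open ℕₚ.≤-Reasoning
[a+b]!≤a!*b!*2^[a+b] (suc a) (suc b) = begin
  (suc a + suc b) !
    ≡⟨ ℕₚ.*-distribʳ-+ ((a + suc b) !) (suc a) (suc b) ⟩
  suc a * (a + suc b) ! + suc b * (a + suc b) !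
    ≡⟨ cong (λ s → suc a * (a + suc b) ! + suc b * s !) (ℕₚ.+-suc a b) ⟩
  suc a * (a + suc b) ! + suc b * (suc a + b) !
    ≤⟨ ℕₚ.+-mono-≤ (ℕₚ.*-monoʳ-≤ (suc a) ([a+b]!≤a!*b!*2^[a+b] a (suc b)))
                   (ℕₚ.*-monoʳ-≤ (suc b) ([a+b]!≤a!*b!*2^[a+b] (suc a) b)) ⟩
  suc a * (a ! * suc b ! * 2 ^ (a + suc b)) + suc b * (suc a ! * b ! * 2 ^ (suc a + b))
    ≡⟨ cong (λ s → suc a * (a ! * suc b ! * 2 ^ (a + suc b)) + suc b * (suc a ! * b ! * 2 ^ s)) (ℕₚ.+-suc a b) ⟨
  suc a * (a ! * suc b ! * 2 ^ (a + suc b)) + suc b * (suc a ! * b ! * 2 ^ (a + suc b))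
    ≡⟨ collect (suc a) (suc b) (a !) (b !) (2 ^ (a + suc b)) ⟩
  suc a ! * suc b ! * 2 ^ (suc a + suc b) ∎
  where
  open ℕₚ.≤-Reasoning
  collect : ∀ a b f g t → a * (f * (b * g) * t) + b * (a * f * g * t) ≡ a * f * (b * g) * (2 * t)
  collect = solve-∀

-- The weight of a line compared with that of its points.

hit-inject₁ : ∀ (c d : Fin k) → hit (inject₁ c) (inject₁ d) ≡ hit c d
hit-inject₁ c d = cong₂ (λ s t → 𝟙 (s ≡ᵇ t)) (Finₚ.toℕ-inject₁ c) (Finₚ.toℕ-inject₁ d)

hit-fromℕ-inject₁ : ∀ (d : Fin k) → hit (fromℕ k) (inject₁ d) ≡ 0
hit-fromℕ-inject₁ {k} d = hit-≢ {c = fromℕ k} {inject₁ d} Finₚ.fromℕ≢inject₁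

hit-inject₁-fromℕ : ∀ (d : Fin k) → hit (inject₁ d) (fromℕ k) ≡ 0
hit-inject₁-fromℕ {k} d = hit-≢ {c = inject₁ d} {fromℕ k} (Finₚ.fromℕ≢inject₁ ∘ sym)

count-substTop : ∀ (j : Fin k) (z : Vec (Fin (suc k)) n) d →
                 count (substTop j z) d ≡ count z (inject₁ d) + hit j d * count z (fromℕ k)
count-substTop j []      d = sym (ℕₚ.*-zeroʳ (hit j d))
count-substTop {k} j (c ∷ z) d with view c
... | ‵fromℕ rewrite replaceTop-fromℕ j | count-substTop j z d | hit-fromℕ-inject₁ d | hit-refl (fromℕ k) =
  collect (hit j d) (count z (inject₁ d)) (count z (fromℕ k))
  where
  collect : ∀ h a t → h + (a + h * t) ≡ a + h * suc t
  collect = solve-∀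
... | ‵inj₁ {i = e} _ rewrite replaceTop-inject₁ j e | count-substTop j z d | hit-inject₁ e d | hit-inject₁-fromℕ e =
  sym (ℕₚ.+-assoc (hit e d) (count z (inject₁ d)) (hit j d * count z (fromℕ k)))

-- Filling in the wildcards merges two letter classes, of sizes a and b, into one, so the product of
-- a! and b! in the weight becomes (a + b)! and the other factors stay. The ratio of the weights is
-- a binomial coefficient.
weight-substTop : ∀ (j : Fin k) (z : Vec (Fin (suc k)) n) →
  weight (substTop j z) * (count z (inject₁ j) ! * count z (fromℕ k) !) ≡
  weight z * (count z (inject₁ j) + count z (fromℕ k)) !
weight-substTop j []      = refl
weight-substTop {k} j (c ∷ z) with view c
-- A wildcard at the head adds one to the merged class of the point and one to the wildcards of the
-- line.
... | ‵fromℕ rewrite replaceTop-fromℕ j | count-substTop j z j | hit-refl j | hit-fromℕ-inject₁ j | hit-refl (fromℕ k)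
                   | ℕₚ.+-identityʳ (count z (fromℕ k)) | ℕₚ.+-suc (count z (inject₁ j)) (count z (fromℕ k)) =
  combine (weight (substTop j z)) _ (count z (inject₁ j) !) (count z (fromℕ k)) (weight z) (count z (fromℕ k) !) _ (weight-substTop j z)
  where
  combine : ∀ v s a t w f g → v * (a * f) ≡ w * g → v * suc s * (a * (suc t * f)) ≡ w * suc t * (suc s * g)
  combine v s a t w f g eq = trans (l v s a t f) (trans (cong (suc s * suc t *_) eq) (r w s t g))
    where
    l : ∀ v s a t f → v * suc s * (a * (suc t * f)) ≡ suc s * suc t * (v * (a * f))
    l = solve-∀
    r : ∀ w s t g → suc s * suc t * (w * g) ≡ w * suc t * (suc s * g)
    r = solve-∀
... | ‵inj₁ {i = e} _ rewrite replaceTop-inject₁ j e | hit-inject₁ e j | hit-inject₁-fromℕ e | count-substTop j z e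
  with e Fin.≟ j
...   | yes refl rewrite hit-refl e | ℕₚ.+-identityʳ (count z (fromℕ k)) =
  combine (weight (substTop j z)) _ (count z (inject₁ e)) (count z (fromℕ k) !) (weight z) (count z (inject₁ e) !) _ (weight-substTop j z)
  where
  combine : ∀ v s a t w f g → v * (f * t) ≡ w * g → v * suc s * (suc a * f * t) ≡ w * suc a * (suc s * g)
  combine v s a t w f g eq = trans (l v s a t f) (trans (cong (suc s * suc a *_) eq) (r w s a g))
    where
    l : ∀ v s a t f → v * suc s * (suc a * f * t) ≡ suc s * suc a * (v * (f * t))
    l = solve-∀
    r : ∀ w s a g → suc s * suc a * (w * g) ≡ w * suc a * (suc s * g)
    r = solve-∀
...   | no e≢j rewrite hit-≢ e≢j | hit-≢ (e≢j ∘ sym) | ℕₚ.+-identityʳ (count z (inject₁ e)) =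
  combine (weight (substTop j z)) _ _ (weight z) _ (weight-substTop j z)
  where
  combine : ∀ v a b w g → v * b ≡ w * g → v * suc a * b ≡ w * suc a * g
  combine v a b w g eq = trans (l v a b) (trans (cong (suc a *_) eq) (r w a g))
    where
    l : ∀ v a b → v * suc a * b ≡ suc a * (v * b)
    l = solve-∀
    r : ∀ w a g → suc a * (w * g) ≡ w * suc a * g
    r = solve-∀

count-pair≤ : ∀ (x : Vec (Fin k) n) {c d} → c ≢ d → count x c + count x d ℕ.≤ n
count-pair≤ []      c≢d = z≤n
count-pair≤ (e ∷ x) {c} {d} c≢d = begin
  hit e c + count x c + (hit e d + count x d)    ≡⟨ interchange (hit e c) (count x c) (hit e d) (count x d) ⟩
  hit e c + hit e d + (count x c + count x d)    ≤⟨ ℕₚ.+-mono-≤ hits≤1 (count-pair≤ x c≢d) ⟩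
  suc _                                          ∎
  where
  open ℕₚ.≤-Reasoning
  interchange : ∀ a b c d → a + b + (c + d) ≡ a + c + (b + d)
  interchange = solve-∀
  hit≤1 : ∀ d → hit e d ℕ.≤ 1
  hit≤1 d with e Fin.≟ d
  ... | yes refl = ℕₚ.≤-reflexive (hit-refl e)
  ... | no e≢d   = ℕₚ.≤-trans (ℕₚ.≤-reflexive (hit-≢ e≢d)) z≤n
  hits≤1 : hit e c + hit e d ℕ.≤ 1
  hits≤1 with e Fin.≟ c
  ... | yes refl rewrite hit-refl e | hit-≢ c≢d = ℕₚ.≤-refl
  ... | no e≢c   rewrite hit-≢ e≢c = hit≤1 d

-- The ratio is a binomial coefficient of a + b, and a + b is at most `n` because the two letters
-- occupy disjoint sets of coordinates.
weight-substTop-≤ : ∀ (j : Fin k) (z : Vec (Fin (suc k)) n) → weight (substTop j z) ℕ.≤ 2 ^ n * weight z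
weight-substTop-≤ {k} {n} j z = ℕₚ.*-cancelʳ-≤ _ _ (a ! * b !) {{ℕₚ.m*n≢0 (a !) (b !) {{a ℕₚ.!≢0}} {{b ℕₚ.!≢0}}}} (begin
  weight (substTop j z) * (a ! * b !)         ≡⟨ weight-substTop j z ⟩
  weight z * (a + b) !                        ≤⟨ ℕₚ.*-monoʳ-≤ (weight z) ([a+b]!≤a!*b!*2^[a+b] a b) ⟩
  weight z * (a ! * b ! * 2 ^ (a + b))        ≤⟨ ℕₚ.*-monoʳ-≤ (weight z) (ℕₚ.*-monoʳ-≤ (a ! * b !)
                                                   (ℕₚ.^-monoʳ-≤ 2 (count-pair≤ z (Finₚ.fromℕ≢inject₁ ∘ sym)))) ⟩
  weight z * (a ! * b ! * 2 ^ n)              ≡⟨ rotate (weight z) (a ! * b !) (2 ^ n) ⟩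
  2 ^ n * weight z * (a ! * b !)              ∎)
  where
  open ℕₚ.≤-Reasoning
  a = count z (inject₁ j)
  b = count z (fromℕ k)
  rotate : ∀ w f p → w * (f * p) ≡ p * w * f
  rotate = solve-∀

mass≤prune+lines : ∀ (S : Subset k n) j → mass S ℕ.≤ mass (prune j S) + 2 ^ n * mass (linesIn S)
mass≤prune+lines {k} {n} S j = begin
  mass S
    ≤⟨ mass-prune S j ⟩
  mass (prune j S) + (∑[ z ∈ L ] (𝟙 (lineIn S z) * weight (substTop j z)))
    ≤⟨ ℕₚ.+-monoʳ-≤ (mass (prune j S)) (∑-mono L λ z → ℕₚ.*-monoʳ-≤ (𝟙 (lineIn S z)) (weight-substTop-≤ j z)) ⟩
  mass (prune j S) + (∑[ z ∈ L ] (𝟙 (lineIn S z) * (2 ^ n * weight z)))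
    ≡⟨ cong (mass (prune j S) +_) (trans (∑-cong L λ z → left-comm (𝟙 (lineIn S z)) (2 ^ n) (weight z)) (∑-*ˡ L (2 ^ n) _)) ⟩
  mass (prune j S) + 2 ^ n * mass (linesIn S) ∎
  where
  open ℕₚ.≤-Reasoning
  L = allPoints (suc k) n
  left-comm : ∀ a b c → a * (b * c) ≡ b * (a * c)
  left-comm = solve-∀

-- Supersaturation in higher dimensions.

-- Relative to dimension `m`, the coefficient of the line mass shrinks by the factor m/N. The
-- induction hypothesis is summed over all coordinates and rules: for each of the N + 1 coordinates
-- the restrictions have total mass `mass S`, while over all coordinates together their line masses
-- total at most N times that of `S`. The resulting factors N/(N + 1) telescope.
supersaturation : ∀ {k m} p q C → .{{NonZero m}} →
  (∀ (S : Subset (suc k) m) → q * mass S ℕ.≤ p * total (suc k) m + C * mass (linesIn S)) →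
  ∀ {N} → m ≤′ N → (S : Subset (suc k) N) →
  N * (q * mass S) ℕ.≤ N * (p * total (suc k) N) + m * (C * mass (linesIn S))
supersaturation {k} {m} p q C base ≤′-refl S = begin
  m * (q * mass S)                                           ≤⟨ ℕₚ.*-monoʳ-≤ m (base S) ⟩
  m * (p * total (suc k) m + C * mass (linesIn S))           ≡⟨ ℕₚ.*-distribˡ-+ m (p * total (suc k) m) (C * mass (linesIn S)) ⟩
  m * (p * total (suc k) m) + m * (C * mass (linesIn S))     ∎
  where open ℕₚ.≤-Reasoning
-- The induction hypothesis carries a factor `N`, which is cancelled at the end; it is positive
-- since 1 ≤ m ≤ N.
supersaturation {k} {m} p q C base (≤′-step {N} m≤N) S = ℕₚ.*-cancelˡ-≤ N {{ℕ.>-nonZero (ℕₚ.≤-trans (ℕ.>-nonZero⁻¹ m) (ℕₚ.≤′⇒≤ m≤N))}} (begin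
  N * (suc N * (q * mass S))
    ≡⟨ swap N (suc N) q (mass S) ⟩
  suc N * (N * q * mass S)
    ≡⟨ ∑-allFin-const (suc N) (N * q * mass S) ⟨
  ∑[ i ∈ I ] (N * q * mass S)
    ≡⟨ ∑-cong I (λ i → cong (N * q *_) (∑-mass-restrict S i)) ⟨
  ∑[ i ∈ I ] (N * q * (∑[ r ∈ R ] mass (restrict S i r)))
    ≡⟨ ∑-cong I (λ i → ∑-*ˡ R (N * q) (λ r → mass (restrict S i r))) ⟨
  ∑[ i ∈ I ] ∑[ r ∈ R ] (N * q * mass (restrict S i r))
    ≤⟨ ∑-mono I (λ i → ∑-mono R λ r → IH (restrict S i r)) ⟩
  ∑[ i ∈ I ] ∑[ r ∈ R ] (N * (p * total (suc k) N) + m * C * mass (linesIn (restrict S i r)))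
    ≡⟨ ∑-cong I (λ i → ∑-+ R (λ _ → N * (p * total (suc k) N)) (λ r → m * C * mass (linesIn (restrict S i r)))) ⟩
  ∑[ i ∈ I ] ((∑[ r ∈ R ] (N * (p * total (suc k) N))) + (∑[ r ∈ R ] (m * C * mass (linesIn (restrict S i r)))))
    ≡⟨ ∑-cong I (λ i → cong₂ _+_ (∑-rules-const (suc k) N _) (∑-*ˡ R (m * C) (λ r → mass (linesIn (restrict S i r))))) ⟩
  ∑[ i ∈ I ] ((N + suc k) * (N * (p * total (suc k) N)) + m * C * (∑[ r ∈ R ] mass (linesIn (restrict S i r))))
    ≡⟨ trans (∑-+ I (λ _ → (N + suc k) * (N * (p * total (suc k) N))) (λ i → m * C * (∑[ r ∈ R ] mass (linesIn (restrict S i r)))))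
             (cong₂ _+_ (∑-allFin-const (suc N) _) (∑-*ˡ I (m * C) (λ i → ∑[ r ∈ R ] mass (linesIn (restrict S i r))))) ⟩
  suc N * ((N + suc k) * (N * (p * total (suc k) N))) + m * C * (∑[ i ∈ I ] ∑[ r ∈ R ] mass (linesIn (restrict S i r)))
    ≤⟨ ℕₚ.+-monoʳ-≤ (suc N * ((N + suc k) * (N * (p * total (suc k) N)))) (ℕₚ.*-monoʳ-≤ (m * C) (∑-mass-linesIn-restrict S)) ⟩
  suc N * ((N + suc k) * (N * (p * total (suc k) N))) + m * C * (N * mass (linesIn S))
    ≡⟨ collect N (N + suc k) p (total (suc k) N) m C (mass (linesIn S)) ⟩
  N * (suc N * (p * ((N + suc k) * total (suc k) N)) + m * (C * mass (linesIn S)))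
    -- The number of rules times the old normalising constant is the new one.
    ≡⟨ cong (λ t → N * (suc N * (p * t) + m * (C * mass (linesIn S)))) (total-suc k N) ⟨
  N * (suc N * (p * total (suc k) (suc N)) + m * (C * mass (linesIn S))) ∎)
  where
  open ℕₚ.≤-Reasoning
  I = allFin (suc N)
  R = rules (suc k) N
  swap : ∀ n s q x → n * (s * (q * x)) ≡ s * (n * q * x)
  swap = solve-∀
  collect : ∀ n s p t m c l → suc n * (s * (n * (p * t))) + m * c * (n * l) ≡ n * (suc n * (p * (s * t)) + m * (c * l))
  collect = solve-∀
  IH : ∀ (S′ : Subset (suc k) N) → N * q * mass S′ ℕ.≤ N * (p * total (suc k) N) + m * C * mass (linesIn S′)
  IH S′ = begin
    N * q * mass S′                                              ≡⟨ ℕₚ.*-assoc N q (mass S′) ⟩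
    N * (q * mass S′)                                            ≤⟨ supersaturation p q C base m≤N S′ ⟩
    N * (p * total (suc k) N) + m * (C * mass (linesIn S′))            ≡⟨ cong (N * (p * total (suc k) N) +_) (ℕₚ.*-assoc m C (mass (linesIn S′))) ⟨
    N * (p * total (suc k) N) + m * C * mass (linesIn S′)              ∎

-- Rational densities

-- Opened only here because +_ makes sections (a +_) of natural addition ambiguous.
open import Data.Integer using (+_)

private variable
  a b c d : ℕ
  x y : ℚ

ι : ℕ → ℚ
ι n = + n ℚ./ 1

toℚᵘ-ι : ∀ n → toℚᵘ (ι n) ℚᵘ.≃ mkℚᵘ (+ n) 0
toℚᵘ-ι n = ℚₚ.toℚᵘ-fromℚᵘ (mkℚᵘ (+ n) 0)

ι-+ : ∀ a b → ι (a + b) ≡ ι a ℚ.+ ι b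
ι-+ a b = ℚₚ.toℚᵘ-injective (begin
  toℚᵘ (ι (a + b))                     ≈⟨ toℚᵘ-ι (a + b) ⟩
  mkℚᵘ (+ (a + b)) 0                   ≈⟨ *≡* (cong (ℤ._* + 1) (sym (cong₂ ℤ._+_ (ℤₚ.*-identityʳ (+ a)) (ℤₚ.*-identityʳ (+ b))))) ⟩
  mkℚᵘ (+ a) 0 ℚᵘ.+ mkℚᵘ (+ b) 0       ≈⟨ ℚᵘₚ.+-cong (toℚᵘ-ι a) (toℚᵘ-ι b) ⟨
  toℚᵘ (ι a) ℚᵘ.+ toℚᵘ (ι b)           ≈⟨ ℚₚ.toℚᵘ-homo-+ (ι a) (ι b) ⟨
  toℚᵘ (ι a ℚ.+ ι b)                   ∎)
  where open import Relation.Binary.Reasoning.Setoid ℚᵘₚ.≃-setoid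

ι-* : ∀ a b → ι (a * b) ≡ ι a ℚ.* ι b
ι-* a b = ℚₚ.toℚᵘ-injective (begin
  toℚᵘ (ι (a * b))                     ≈⟨ toℚᵘ-ι (a * b) ⟩
  mkℚᵘ (+ (a * b)) 0                   ≈⟨ *≡* (cong (ℤ._* + 1) (ℤₚ.pos-* a b)) ⟩
  mkℚᵘ (+ a) 0 ℚᵘ.* mkℚᵘ (+ b) 0       ≈⟨ ℚᵘₚ.*-cong (toℚᵘ-ι a) (toℚᵘ-ι b) ⟨
  toℚᵘ (ι a) ℚᵘ.* toℚᵘ (ι b)           ≈⟨ ℚₚ.toℚᵘ-homo-* (ι a) (ι b) ⟨
  toℚᵘ (ι a ℚ.* ι b)                   ∎)
  where open import Relation.Binary.Reasoning.Setoid ℚᵘₚ.≃-setoid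

ι-mono-≤ : a ℕ.≤ b → ι a ≤ ι b
ι-mono-≤ {a} {b} a≤b = ℚₚ.toℚᵘ-cancel-≤ (begin
  toℚᵘ (ι a)      ≃⟨ toℚᵘ-ι a ⟩
  mkℚᵘ (+ a) 0    ≤⟨ *≤* (ℤₚ.*-monoʳ-≤-nonNeg (+ 1) (ℤ.+≤+ a≤b)) ⟩
  mkℚᵘ (+ b) 0    ≃⟨ toℚᵘ-ι b ⟨
  toℚᵘ (ι b)      ∎)
  where open ℚᵘₚ.≤-Reasoning

ι-cancel-≤ : ι a ≤ ι b → a ℕ.≤ b
ι-cancel-≤ {a} {b} ιa≤ιb = ℤₚ.drop‿+≤+ (ℤₚ.*-cancelʳ-≤-pos (+ a) (+ b) (+ 1) (ℚᵘₚ.drop-*≤* (begin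
  mkℚᵘ (+ a) 0    ≃⟨ toℚᵘ-ι a ⟨
  toℚᵘ (ι a)      ≤⟨ ℚₚ.toℚᵘ-mono-≤ ιa≤ιb ⟩
  toℚᵘ (ι b)      ≃⟨ toℚᵘ-ι b ⟩
  mkℚᵘ (+ b) 0    ∎)))
  where open ℚᵘₚ.≤-Reasoning

ι-positive : ∀ n → .{{NonZero n}} → Positive (ι n)
ι-positive n = ℚₚ.normalize-pos n 1

-- x = a / b, without requiring lowest terms
infix 4 _is_/_
record _is_/_ (x : ℚ) (a b : ℕ) : Set where
  constructor cleared
  field clear : x ℚ.* ι b ≡ ι a

open _is_/_

rescale : ∀ c → x is a / b → x is a * c / b * c
rescale {x} {a} {b} c (cleared eq) = cleared (begin
  x ℚ.* ι (b * c)        ≡⟨ cong (x ℚ.*_) (ι-* b c) ⟩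
  x ℚ.* (ι b ℚ.* ι c)    ≡⟨ ℚₚ.*-assoc x (ι b) (ι c) ⟨
  x ℚ.* ι b ℚ.* ι c      ≡⟨ cong (ℚ._* ι c) eq ⟩
  ι a ℚ.* ι c            ≡⟨ ι-* a c ⟨
  ι (a * c)              ∎)
  where open ≡-Reasoning

*-is-/ : x is a / b → y is c / d → x ℚ.* y is a * c / b * d
*-is-/ {x} {a} {b} {y} {c} {d} (cleared eq₁) (cleared eq₂) = cleared (begin
  x ℚ.* y ℚ.* ι (b * d)            ≡⟨ cong (x ℚ.* y ℚ.*_) (ι-* b d) ⟩
  x ℚ.* y ℚ.* (ι b ℚ.* ι d)        ≡⟨ interchange x y (ι b) (ι d) ⟩
  x ℚ.* ι b ℚ.* (y ℚ.* ι d)        ≡⟨ cong₂ ℚ._*_ eq₁ eq₂ ⟩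
  ι a ℚ.* ι c                      ≡⟨ ι-* a c ⟨
  ι (a * c)                        ∎)
  where
  open ≡-Reasoning
  open import Algebra.Properties.CommutativeSemigroup
    (CommutativeMonoid.commutativeSemigroup ℚₚ.*-1-commutativeMonoid) using (interchange)

÷-is-/ : ∀ c .{{_ : ℚ.NonZero (ι c)}} → x is a / b → x ÷ ι c is a / b * c
÷-is-/ {x} {a} {b} c eq = subst (λ t → x ÷ ι c is t / b * c) (ℕₚ.*-identityʳ a) (*-is-/ eq (cleared {b = c} (ℚₚ.*-inverseˡ (ι c))))

is-/-mono : x is a / b → y is c / d → x ≤ y → a * d ℕ.≤ c * b
is-/-mono {x} {a} {b} {y} {c} {d} eq₁ eq₂ x≤y = ι-cancel-≤ (begin
  ι (a * d)          ≡⟨ clear (rescale d eq₁) ⟨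
  x ℚ.* ι (b * d)    ≤⟨ ℚₚ.*-monoʳ-≤-nonNeg (ι (b * d)) {{ℚ.nonNegative (ι-mono-≤ {0} {b * d} z≤n)}} x≤y ⟩
  y ℚ.* ι (b * d)    ≡⟨ cong (λ t → y ℚ.* ι t) (ℕₚ.*-comm b d) ⟩
  y ℚ.* ι (d * b)    ≡⟨ clear (rescale b eq₂) ⟩
  ι (c * b)          ∎)
  where open ℚₚ.≤-Reasoning

is-/-cancel : .{{NonZero b}} → .{{NonZero d}} → x is a / b → y is c / d → a * d ℕ.≤ c * b → x ≤ y
is-/-cancel {b} {d} {x} {a} {y} {c} eq₁ eq₂ ad≤cb = ℚₚ.*-cancelʳ-≤-pos (ι (b * d)) {{ι-positive (b * d) {{ℕₚ.m*n≢0 b d}}}} (begin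
  x ℚ.* ι (b * d)    ≡⟨ clear (rescale d eq₁) ⟩
  ι (a * d)          ≤⟨ ι-mono-≤ ad≤cb ⟩
  ι (c * b)          ≡⟨ clear (rescale b eq₂) ⟨
  y ℚ.* ι (d * b)    ≡⟨ cong (λ t → y ℚ.* ι t) (ℕₚ.*-comm b d) ⟨
  y ℚ.* ι (b * d)    ∎)
  where open ℚₚ.≤-Reasoning

-- The positivity of `q` matters: `frac 1 0` is 0 by convention, and the cleared equation would
-- fail.
frac-is-/ : ∀ q → .{{NonZero q}} → frac 1 q is 1 / q
frac-is-/ (suc q) = cleared (ℚₚ.toℚᵘ-injective (begin
  toℚᵘ (frac 1 (suc q) ℚ.* ι (suc q))               ≈⟨ ℚₚ.toℚᵘ-homo-* (frac 1 (suc q)) (ι (suc q)) ⟩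
  toℚᵘ (frac 1 (suc q)) ℚᵘ.* toℚᵘ (ι (suc q))       ≈⟨ ℚᵘₚ.*-cong (ℚₚ.toℚᵘ-fromℚᵘ (mkℚᵘ (+ 1) q)) (toℚᵘ-ι (suc q)) ⟩
  mkℚᵘ (+ 1) q ℚᵘ.* mkℚᵘ (+ suc q) 0                ≈⟨ *≡* (cong +_ (lemma q)) ⟩
  mkℚᵘ (+ 1) 0                                      ≈⟨ toℚᵘ-ι 1 ⟨
  toℚᵘ (ι 1)                                        ∎))
  where
  open import Relation.Binary.Reasoning.Setoid ℚᵘₚ.≃-setoid
  lemma : ∀ q → (1 * suc q) * 1 ≡ 1 * (suc q * 1)
  lemma = solve-∀

positive-is-/ : ∀ x → .{{Positive x}} → ∃₂ λ a b → NonZero b × x is a / b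
positive-is-/ (mkℚ +[1+ a ] b-1 _) = suc a , suc b-1 , _ , cleared (ℚₚ.toℚᵘ-injective (begin
  toℚᵘ (mkℚ +[1+ a ] b-1 _ ℚ.* ι (suc b-1))         ≈⟨ ℚₚ.toℚᵘ-homo-* (mkℚ +[1+ a ] b-1 _) (ι (suc b-1)) ⟩
  mkℚᵘ +[1+ a ] b-1 ℚᵘ.* toℚᵘ (ι (suc b-1))         ≈⟨ ℚᵘₚ.*-congˡ {mkℚᵘ +[1+ a ] b-1} (toℚᵘ-ι (suc b-1)) ⟩
  mkℚᵘ +[1+ a ] b-1 ℚᵘ.* mkℚᵘ (+ suc b-1) 0         ≈⟨ *≡* (cong +_ (lemma (suc a) (suc b-1))) ⟩
  mkℚᵘ (+ suc a) 0                                  ≈⟨ toℚᵘ-ι (suc a) ⟨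
  toℚᵘ (ι (suc a))                                  ∎))
  where
  open import Relation.Binary.Reasoning.Setoid ℚᵘₚ.≃-setoid
  lemma : ∀ a b → (a * b) * 1 ≡ a * (b * 1)
  lemma = solve-∀

total≢0 : ∀ k n → NonZero (total (suc k) n)
total≢0 k n = ℕₚ.m*n≢0⇒m≢0 (total (suc k) n) {k !} {{subst NonZero (sym (total-! k n)) ((n + k) ℕₚ.!≢0)}}

-- By `sliceSize*weight`, the factor `n !` in `total` is the slice size times the weight, so all
-- points get a common denominator.
esWeight-is-/ : ∀ (x : Vec (Fin (suc k)) n) → esWeight x is weight x / total (suc k) n
esWeight-is-/ {k} {n} x = cleared (begin
  esWeight x ℚ.* ι (total (suc k) n)    ≡⟨ cong (λ t → esWeight x ℚ.* ι t) total≡ ⟩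
  esWeight x ℚ.* ι (q * weight x)       ≡⟨ clear (rescale (weight x) (frac-is-/ q {{q≢0}})) ⟩
  ι (1 * weight x)                      ≡⟨ cong ι (ℕₚ.*-identityˡ (weight x)) ⟩
  ι (weight x)                          ∎)
  where
  open ≡-Reasoning
  q = #compositions (suc k) n * sliceSize x
  total≡ : total (suc k) n ≡ q * weight x
  total≡ = trans (cong (#compositions (suc k) n *_) (sym (sliceSize*weight x)))
                 (sym (ℕₚ.*-assoc (#compositions (suc k) n) (sliceSize x) (weight x)))
  q≢0 : NonZero q
  q≢0 = ℕₚ.m*n≢0⇒m≢0 q {weight x} {{subst NonZero total≡ (total≢0 k n)}}

esDensity-is-/ : ∀ (S : Subset (suc k) n) → esDensity S is mass S / total (suc k) n
esDensity-is-/ {k} {n} S = go (allPoints (suc k) n)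
  where
  open ≡-Reasoning
  t = total (suc k) n
  term : Vec (Fin (suc k)) n → ℚ
  term x = if S x then esWeight x else 0ℚ
  term-is-/ : ∀ x → term x is 𝟙 (S x) * weight x / t
  term-is-/ x with S x
  ... | true  = subst (esWeight x is_/ t) (sym (ℕₚ.*-identityˡ (weight x))) (esWeight-is-/ x)
  ... | false = cleared (ℚₚ.*-zeroˡ (ι t))
  go : ∀ xs → foldr (λ x s → term x ℚ.+ s) 0ℚ xs is ∑[ x ∈ xs ] (𝟙 (S x) * weight x) / t
  go []       = cleared (ℚₚ.*-zeroˡ (ι t))
  go (x ∷ xs) = cleared (begin
    (term x ℚ.+ foldr (λ x s → term x ℚ.+ s) 0ℚ xs) ℚ.* ι t
      ≡⟨ ℚₚ.*-distribʳ-+ (ι t) (term x) (foldr (λ x s → term x ℚ.+ s) 0ℚ xs) ⟩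
    term x ℚ.* ι t ℚ.+ foldr (λ x s → term x ℚ.+ s) 0ℚ xs ℚ.* ι t
      ≡⟨ cong₂ ℚ._+_ (clear (term-is-/ x)) (clear (go xs)) ⟩
    ι (𝟙 (S x) * weight x) ℚ.+ ι (∑[ y ∈ xs ] (𝟙 (S y) * weight y))
      ≡⟨ ι-+ (𝟙 (S x) * weight x) (∑[ y ∈ xs ] (𝟙 (S y) * weight y)) ⟨
    ι (∑[ y ∈ x ∷ xs ] (𝟙 (S y) * weight y)) ∎)

-- Numerical estimates and conclusion.

-- Absorbs both losses into (k+1)^m: the factor 2^m from deleting points and the factor (m + k)/k
-- from the change of alphabet.
[m+k]*2^m≤k*[1+k]^m : ∀ m k → 2 ℕ.≤ k → (m + k) * 2 ^ m ℕ.≤ k * suc k ^ m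
[m+k]*2^m≤k*[1+k]^m zero    k 2≤k = ℕₚ.≤-refl
[m+k]*2^m≤k*[1+k]^m (suc m) k@(suc (suc l)) 2≤k = begin
  -- With k = l + 2, the added term is exactly the surplus of (k + 1)(m + k) over 2(m + 1 + k),
  -- times 2^m.
  (suc m + k) * (2 * 2 ^ m)                                  ≤⟨ ℕₚ.m≤m+n _ ((m + (m + k + 1) * l) * 2 ^ m) ⟩
  (suc m + k) * (2 * 2 ^ m) + (m + (m + k + 1) * l) * 2 ^ m  ≡⟨ expand m l (2 ^ m) ⟩
  suc k * ((m + k) * 2 ^ m)                                  ≤⟨ ℕₚ.*-monoʳ-≤ (suc k) ([m+k]*2^m≤k*[1+k]^m m k 2≤k) ⟩
  suc k * (k * suc k ^ m)                                    ≡⟨ left-comm (suc k) k (suc k ^ m) ⟩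
  k * (suc k * suc k ^ m)                                    ∎
  where
  open ℕₚ.≤-Reasoning
  expand : ∀ m l t → (suc m + suc (suc l)) * (2 * t) + (m + (m + suc (suc l) + 1) * l) * t ≡ suc (suc (suc l)) * ((m + suc (suc l)) * t)
  expand = solve-∀
  left-comm : ∀ a b c → a * (b * c) ≡ b * (a * c)
  left-comm = solve-∀
[m+k]*2^m≤k*[1+k]^m (suc m) 1 (s≤s ())

-- Here p/q is the density threshold, `M` and `L` are the masses of the set and of its lines, and
-- `T` and `T′` normalise points and lines. A quarter of the threshold is lost to the line-free
-- part, and the remaining three quarters must come from lines.
final-inequality : ∀ {k m n p q M L T T′} → .{{NonZero n}} → 2 ℕ.≤ k → m ℕ.≤ n → k * T′ ≡ (n + k) * T →
  p * T ℕ.≤ M * q → n * (q * 4 * M) ℕ.≤ n * (p * T) + m * (q * 4 * 2 ^ m * L) →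
  p * T′ ℕ.≤ L * (q * 9 * suc k ^ m)
final-inequality {k@(suc _)} {m} {n} {p} {q} {M} {L} {T} {T′} 2≤k m≤n kT′ pT≤Mq bound =
  ℕₚ.*-cancelˡ-≤ (3 * (k * n)) {{ℕₚ.m*n≢0 3 (k * n) {{_}} {{ℕₚ.m*n≢0 k n}}}} (begin
    3 * (k * n) * (p * T′)
      ≡⟨ e₁ k n p T′ ⟩
    3 * (n * p) * (k * T′)
      ≡⟨ cong (3 * (n * p) *_) kT′ ⟩
    3 * (n * p) * ((n + k) * T)
      ≡⟨ e₂ n p k T ⟩
    3 * (n * (p * T)) * (n + k)
      ≤⟨ ℕₚ.*-monoˡ-≤ (n + k) 3npT≤ ⟩
    m * (q * 4 * 2 ^ m * L) * (n + k)
      ≡⟨ e₃ m q (2 ^ m) L n k ⟩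
    4 * q * L * (m * (n + k) * 2 ^ m)
      -- The ratio (n + k)/n is largest at n = m, so the estimate reduces to dimension `m`.
      ≤⟨ ℕₚ.*-monoʳ-≤ (4 * q * L) (ℕₚ.*-monoˡ-≤ (2 ^ m) m[n+k]≤n[m+k]) ⟩
    4 * q * L * (n * (m + k) * 2 ^ m)
      ≡⟨ cong (4 * q * L *_) (ℕₚ.*-assoc n (m + k) (2 ^ m)) ⟩
    4 * q * L * (n * ((m + k) * 2 ^ m))
      ≤⟨ ℕₚ.*-monoʳ-≤ (4 * q * L) (ℕₚ.*-monoʳ-≤ n ([m+k]*2^m≤k*[1+k]^m m k 2≤k)) ⟩
    4 * q * L * (n * (k * suc k ^ m))
      -- The target has coefficient 3 · 9 = 27 = 4 + 23.
      ≤⟨ ℕₚ.m≤m+n _ (23 * q * L * (n * (k * suc k ^ m))) ⟩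
    4 * q * L * (n * (k * suc k ^ m)) + 23 * q * L * (n * (k * suc k ^ m))
      ≡⟨ e₄ q L n k (suc k ^ m) ⟩
    3 * (k * n) * (L * (q * 9 * suc k ^ m)) ∎)
  where
  open ℕₚ.≤-Reasoning
  e₁ : ∀ k n p t → 3 * (k * n) * (p * t) ≡ 3 * (n * p) * (k * t)
  e₁ = solve-∀
  e₂ : ∀ n p k t → 3 * (n * p) * ((n + k) * t) ≡ 3 * (n * (p * t)) * (n + k)
  e₂ = solve-∀
  e₃ : ∀ m q t l n k → m * (q * 4 * t * l) * (n + k) ≡ 4 * q * l * (m * (n + k) * t)
  e₃ = solve-∀
  e₄ : ∀ q l n k t → 4 * q * l * (n * (k * t)) + 23 * q * l * (n * (k * t)) ≡ 3 * (k * n) * (l * (q * 9 * t))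
  e₄ = solve-∀
  e₅ : ∀ n a → n * a + 3 * (n * a) ≡ n * (4 * a)
  e₅ = solve-∀
  e₆ : ∀ n q m → n * (4 * (m * q)) ≡ n * (q * 4 * m)
  e₆ = solve-∀
  3npT≤ : 3 * (n * (p * T)) ℕ.≤ m * (q * 4 * 2 ^ m * L)
  3npT≤ = ℕₚ.+-cancelˡ-≤ (n * (p * T)) _ _ (begin
    n * (p * T) + 3 * (n * (p * T))                    ≡⟨ e₅ n (p * T) ⟩
    n * (4 * (p * T))                                  ≤⟨ ℕₚ.*-monoʳ-≤ n (ℕₚ.*-monoʳ-≤ 4 pT≤Mq) ⟩
    n * (4 * (M * q))                                  ≡⟨ e₆ n q M ⟩
    n * (q * 4 * M)                                    ≤⟨ bound ⟩
    n * (p * T) + m * (q * 4 * 2 ^ m * L)              ∎)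
  m[n+k]≤n[m+k] : m * (n + k) ℕ.≤ n * (m + k)
  m[n+k]≤n[m+k] = begin
    m * (n + k)      ≡⟨ ℕₚ.*-distribˡ-+ m n k ⟩
    m * n + m * k    ≤⟨ ℕₚ.+-mono-≤ (ℕₚ.≤-reflexive (ℕₚ.*-comm m n)) (ℕₚ.*-monoˡ-≤ k m≤n) ⟩
    n * m + n * k    ≡⟨ ℕₚ.*-distribˡ-+ n m k ⟨
    n * (m + k)      ∎

-- Removing the point at letter `zero` from every line leaves a line-free set, which is sparse by
-- hypothesis; the removed mass is at most 2^m times the mass of the lines.
EDHJ⇒base : ∀ {k m p q} {α : ℚ} → EDHJProp (suc k) α m → α is p / q → ∀ (S : Subset (suc k) m) →
  q * mass S ℕ.≤ p * total (suc k) m + q * 2 ^ m * mass (linesIn S)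
EDHJ⇒base {k} {m} {p} {q} {α} edhj α-is S = begin
  q * mass S
    ≤⟨ ℕₚ.*-monoʳ-≤ q (mass≤prune+lines S zero) ⟩
  q * (mass S′ + 2 ^ m * mass (linesIn S))
    ≡⟨ expand q (mass S′) (2 ^ m) (mass (linesIn S)) ⟩
  mass S′ * q + q * 2 ^ m * mass (linesIn S)
    ≤⟨ ℕₚ.+-monoˡ-≤ (q * 2 ^ m * mass (linesIn S)) (is-/-mono (esDensity-is-/ S′) α-is sparse) ⟩
  p * total (suc k) m + q * 2 ^ m * mass (linesIn S) ∎
  where
  open ℕₚ.≤-Reasoning
  S′ = prune zero S
  sparse : esDensity S′ ≤ α
  -- Density at least `α` would force a line in the pruned set.
  sparse = ℚₚ.<⇒≤ (ℚₚ.≰⇒> λ α≤ → prune-lineFree S zero (edhj S′ α≤))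
  expand : ∀ q a t l → q * (a + t * l) ≡ a * q + q * t * l
  expand = solve-∀

theorem3p8 : (δ : ℚ) → {{δ>0 : Positive δ}} → (k : ℕ) → 2 ℕ.≤ k →
    (m : ℕ) → IsEDHJ k (δ ÷ ((+ 4) ℚ./ 1)) m →
    (n : ℕ) → m ℕ.≤ n → _÷_ ((+ (4 * k * k)) ℚ./ 1) δ {{pos⇒nonZero δ}} ≤ (+ n) ℚ./ 1 →
    (A : Subset k n) → δ ≤ esDensity A →
    (δ ÷ ((+ 9) ℚ./ 1)) ℚ.* frac 1 (suc k ^ m) ≤ esDensity (linesIn A)
theorem3p8 δ k@(suc k′) 2≤k m (1≤m , edhj , _) n m≤n _ A δ≤dens
  with p , q , q≢0 , δ-is ← positive-is-/ δ =
  is-/-cancel {{ℕₚ.m*n≢0 (q * 9) (suc k ^ m) {{ℕₚ.m*n≢0 q 9 {{q≢0}}}} {{ℕₚ.m^n≢0 (suc k) m}}}} {{total≢0 k n}}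
    (*-is-/ (÷-is-/ 9 δ-is) (frac-is-/ (suc k ^ m) {{ℕₚ.m^n≢0 (suc k) m}})) (esDensity-is-/ (linesIn A))
    -- The numerator 1 of the last fraction makes the product's numerator `p * 1`.
    (subst (λ p → p * total (suc k) n ℕ.≤ mass (linesIn A) * (q * 9 * suc k ^ m)) (sym (ℕₚ.*-identityʳ p))
      (final-inequality {p = p} {q} {mass A} {{n≢0}} 2≤k m≤n (total-alphabet-suc k′ n)
        (is-/-mono δ-is (esDensity-is-/ A) δ≤dens) bound))
  where
  m≢0 : NonZero m
  m≢0 = ℕ.>-nonZero 1≤m
  n≢0 : NonZero n
  n≢0 = ℕ.>-nonZero (ℕₚ.≤-trans 1≤m m≤n)
  bound : n * (q * 4 * mass A) ℕ.≤ n * (p * total k n) + m * (q * 4 * 2 ^ m * mass (linesIn A))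
  -- Since δ = p/q, the threshold δ/4 is p over `q * 4`, and the same denominator multiplies the
  -- loss 2^m.
  bound = supersaturation p (q * 4) (q * 4 * 2 ^ m) {{m≢0}} (EDHJ⇒base edhj (÷-is-/ 4 δ-is)) (ℕₚ.≤⇒≤′ m≤n) A
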